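{- Let $q$ be an odd prime power, $d\ge2$, $Q$ a nondegenerate quadratic form on $\mathbb F_q^d$, $P\subseteq\mathbb F_q^d$ nonempty and $\mathcal S$ a nonempty family of distinct $Q$-spheres. Put $\mu=1-\frac{I(P,\mathcal S)}{|P||\mathcal S|}$, assume $0\le\mu<\frac{d+1}{(d+2)^2}$, and put $\delta=\sqrt{(d+1)\mu}$. Suppose that for some $\gamma>\delta$, $$|P\cap V|\le(1-\gamma)|P|$$ for every affine flat $V\subseteq\mathbb F_q^d$ of codimension two. Then there exist an affine subspace $L\subseteq\mathbb F_q^{d+1}$ and subsets $P_0\subseteq P\cap B(L)$, $\mathcal S_0\subseteq\mathcal S\cap\mathcal S(L)$ with $$|P_0|\ge(1-\delta)|P|,\qquad|\mathcal S_0|\ge(1-\delta)|\mathcal S|,$$ and every such classifying space $L$ has dimension at most one. If moreover $(1-\delta)|\mathcal S|\ge2$, then $\dim L=1$: after deleting at most a $\delta$-fraction from each side, the remaining spheres lie in one coaxal pencil $\mathcal S(L)$ and the remaining points lie in its common sphere-pair section $B(L)=S\cap S'$ ($S\ne S'$ any two members of the pencil).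
   Context: Put $\langle x,y\rangle_Q=\frac{Q(x+y)-Q(x)-Q(y)}2$. For $c\in\mathbb F_q^d$, $r\in\mathbb F_q$ the $Q$-sphere is $S_Q(c,r)=\{x\in\mathbb F_q^d:Q(x-c)=r\}$; spheres are parametrized by pairs $(c,r)$ and distinct spheres means distinct parameter pairs. $I(P,\mathcal S)=|\{(p,S)\in P\times\mathcal S:p\in S\}|$. The lift is $\Phi(S_Q(c,r))=(2c,r-Q(c))\in\mathbb F_q^{d+1}$. For $x\in\mathbb F_q^d$, $y=(u,a)\in\mathbb F_q^d\times\mathbb F_q$ put $\Lambda_x(y)=Q(x)-\langle x,u\rangle_Q-a$. For a (nonempty) affine subspace $L\subseteq\mathbb F_q^{d+1}$ put $\mathcal S(L)=\Phi^{ -1}(L)$ and $B(L)=\{x\in\mathbb F_q^d:\Lambda_x(y)=0\ \forall y\in L\}$. A coaxal pencil is the $q$-member family of spheres whose lifts form an affine line in $\mathbb F_q^{d+1}$ (the line through the lifts of two distinct spheres $S_0,S_1$); any two distinct members have the same intersection $S_0\cap S_1$. -}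

module Defs where

open import Level using (0ℓ)
open import Algebra.Apartness.Structures using (IsHeytingField)
open import Data.Fin.Base using (Fin)
import Data.Fin.Properties as Fin
open import Data.Integer.Base using (+_)
open import Data.List.Base using (List; length; filter; cartesianProduct)
import Data.List.Membership.Propositional as ListMembership
open import Data.List.Relation.Unary.Unique.Propositional using (Unique)
open import Data.Nat.Base as ℕ using (ℕ; zero; suc)
import Data.Nat.Properties as ℕ
open import Data.Nat.Divisibility using (_∣_)
open import Data.Nat.Primality using (Prime)
open import Data.Product.Base using (∃; ∃-syntax; ∃₂; _×_; _,_; proj₁; proj₂)
open import Data.Rational.Base as ℚ using (ℚ; 0ℚ; 1ℚ)
import Data.Rational.Properties as ℚ
open import Algebra.Properties.Group ℚ.+-0-group using (⁻¹-involutive)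
open import Data.Sum.Base using (_⊎_; inj₁; inj₂; [_,_]′)
open import Data.Vec.Base as Vec using (Vec; []; _∷_; _∷ʳ_; init; last; replicate; zipWith)
open import Data.Vec.Properties using (≡-dec)
open import Function.Base using (_∘_)
open import Function.Bundles using (_↔_; _⇔_; module Inverse)
open import Function.Properties.Inverse using (↔⇒↣)
open import Relation.Binary.Definitions using (DecidableEquality)
open import Relation.Binary.PropositionalEquality
  using (_≡_; _≢_; refl; sym; trans; cong; subst; module ≡-Reasoning)
open import Relation.Nullary using (¬_; Dec; yes; no)
open import Relation.Nullary.Decidable using (map′; via-injection)
open import Relation.Unary using (Pred; Decidable)

-- Real numbers: two-sided Dedekind cuts of ℚ.

record ℝ : Set₁ where
  field
    lower upper   : Pred ℚ 0ℓ
    lower-inhab   : ∃ lower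
    upper-inhab   : ∃ upper
    lower-closed  : ∀ {p q} → p ℚ.< q → lower q → lower p
    upper-closed  : ∀ {p q} → p ℚ.< q → upper p → upper q
    lower-rounded : ∀ {p} → lower p → ∃[ q ] p ℚ.< q × lower q
    upper-rounded : ∀ {q} → upper q → ∃[ p ] p ℚ.< q × upper p
    disjoint      : ∀ {q} → lower q → ¬ upper q
    located       : ∀ {p q} → p ℚ.< q → lower p ⊎ upper q

open ℝ

infix 4 _≤ℝ_ _<ℝ_ _≥ℝ_

_≤ℝ_ : ℝ → ℝ → Set
x ≤ℝ y = ∀ q → lower x q → lower y q

_≥ℝ_ : ℝ → ℝ → Set
x ≥ℝ y = y ≤ℝ x

_<ℝ_ : ℝ → ℝ → Set
x <ℝ y = ∃[ q ] upper x q × lower y q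

private
  p-1<p : ∀ p → p ℚ.- 1ℚ ℚ.< p
  p-1<p p = subst (p ℚ.- 1ℚ ℚ.<_) (ℚ.+-identityʳ p)
    (ℚ.+-monoʳ-< p {ℚ.- 1ℚ} {0ℚ} (ℚ.negative⁻¹ (ℚ.- 1ℚ)))

  p<p+1 : ∀ p → p ℚ.< p ℚ.+ 1ℚ
  p<p+1 p = subst (ℚ._< p ℚ.+ 1ℚ) (ℚ.+-identityʳ p)
    (ℚ.+-monoʳ-< p {0ℚ} {1ℚ} (ℚ.positive⁻¹ 1ℚ))

  1-anti : ∀ {p q} → p ℚ.< q → 1ℚ ℚ.- q ℚ.< 1ℚ ℚ.- p
  1-anti p<q = ℚ.+-monoʳ-< 1ℚ (ℚ.neg-antimono-< p<q)

  1-invol : ∀ p → 1ℚ ℚ.- (1ℚ ℚ.- p) ≡ p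
  1-invol p = begin
    1ℚ ℚ.+ ℚ.- (1ℚ ℚ.+ ℚ.- p)        ≡⟨ cong (1ℚ ℚ.+_) (ℚ.neg-distrib-+ 1ℚ (ℚ.- p)) ⟩
    1ℚ ℚ.+ (ℚ.- 1ℚ ℚ.+ ℚ.- (ℚ.- p))  ≡⟨ sym (ℚ.+-assoc 1ℚ (ℚ.- 1ℚ) (ℚ.- (ℚ.- p))) ⟩
    0ℚ ℚ.+ ℚ.- (ℚ.- p)               ≡⟨ ℚ.+-identityˡ (ℚ.- (ℚ.- p)) ⟩
    ℚ.- (ℚ.- p)                      ≡⟨ ⁻¹-involutive p ⟩
    p                                ∎
    where open ≡-Reasoning

  0<1 : 0ℚ ℚ.< 1ℚ
  0<1 = ℚ.positive⁻¹ 1ℚ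

  recip : ∀ n → ∃[ r ] ℚ.Positive r × (∀ c → c ℚ.* r ℚ.* (+ suc n ℚ./ 1) ≡ c)
  recip n = ℚ.1/ m , ℚ.1/pos⇒pos m , λ c → trans (ℚ.*-assoc c (ℚ.1/ m) m)
      (trans (cong (c ℚ.*_) (ℚ.*-inverseˡ m)) (ℚ.*-identityʳ c))
    where
    m = + suc n ℚ./ 1
    instance
      m>0 : ℚ.Positive m
      m>0 = ℚ.normalize-pos (suc n) 1
      m≢0 : ℚ.NonZero m
      m≢0 = ℚ.pos⇒nonZero m

ℚ→ℝ : ℚ → ℝ
ℚ→ℝ r .lower q = q ℚ.< r
ℚ→ℝ r .upper q = r ℚ.< q
ℚ→ℝ r .lower-inhab = r ℚ.- 1ℚ , p-1<p r
ℚ→ℝ r .upper-inhab = r ℚ.+ 1ℚ , p<p+1 r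
ℚ→ℝ r .lower-closed p<q q<r = ℚ.<-trans p<q q<r
ℚ→ℝ r .upper-closed p<q r<p = ℚ.<-trans r<p p<q
ℚ→ℝ r .lower-rounded = ℚ.<-dense
ℚ→ℝ r .upper-rounded r<q with s , r<s , s<q ← ℚ.<-dense r<q = s , s<q , r<s
ℚ→ℝ r .disjoint q<r r<q = ℚ.<-asym q<r r<q
ℚ→ℝ r .located {p} p<q with p ℚ.<? r
... | yes p<r = inj₁ p<r
... | no  p≮r = inj₂ (ℚ.≤-<-trans (ℚ.≮⇒≥ p≮r) p<q)

ℕ→ℚ : ℕ → ℚ
ℕ→ℚ n = + n ℚ./ 1

ℕ→ℝ : ℕ → ℝ
ℕ→ℝ n = ℚ→ℝ (ℕ→ℚ n)

1-_ : ℝ → ℝ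
(1- x) .lower q = upper x (1ℚ ℚ.- q)
(1- x) .upper q = lower x (1ℚ ℚ.- q)
(1- x) .lower-inhab with u , xu ← upper-inhab x =
  1ℚ ℚ.- u , subst (upper x) (sym (1-invol u)) xu
(1- x) .upper-inhab with l , xl ← lower-inhab x =
  1ℚ ℚ.- l , subst (lower x) (sym (1-invol l)) xl
(1- x) .lower-closed p<q = upper-closed x (1-anti p<q)
(1- x) .upper-closed p<q = lower-closed x (1-anti p<q)
(1- x) .lower-rounded {p} xp with s , s<1-p , xs ← upper-rounded x xp =
  1ℚ ℚ.- s , subst (ℚ._< 1ℚ ℚ.- s) (1-invol p) (1-anti s<1-p)
           , subst (upper x) (sym (1-invol s)) xs
(1- x) .upper-rounded {q} xq with s , 1-q<s , xs ← lower-rounded x xq =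
  1ℚ ℚ.- s , subst (1ℚ ℚ.- s ℚ.<_) (1-invol q) (1-anti 1-q<s)
           , subst (lower x) (sym (1-invol s)) xs
(1- x) .disjoint xl xu = disjoint x xu xl
(1- x) .located p<q = [ inj₂ , inj₁ ]′ (located x (1-anti p<q))

-- Scaling by a natural number. The strict inequalities make the cuts
-- rounded, and correct also for n = 0.

infixl 7 _·ℕ_

_·ℕ_ : ℝ → ℕ → ℝ
(x ·ℕ n) .lower q = ∃[ p ] lower x p × q ℚ.< p ℚ.* ℕ→ℚ n
(x ·ℕ n) .upper q = ∃[ p ] upper x p × p ℚ.* ℕ→ℚ n ℚ.< q
(x ·ℕ n) .lower-inhab with l , xl ← lower-inhab x = _ , l , xl , p-1<p _
(x ·ℕ n) .upper-inhab with u , xu ← upper-inhab x = _ , u , xu , p<p+1 _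
(x ·ℕ n) .lower-closed p<q (l , xl , q<ln) = l , xl , ℚ.<-trans p<q q<ln
(x ·ℕ n) .upper-closed p<q (u , xu , un<p) = u , xu , ℚ.<-trans un<p p<q
(x ·ℕ n) .lower-rounded (l , xl , p<ln) with s , p<s , s<ln ← ℚ.<-dense p<ln =
  s , p<s , l , xl , s<ln
(x ·ℕ n) .upper-rounded (u , xu , un<q) with s , un<s , s<q ← ℚ.<-dense un<q =
  s , s<q , u , xu , un<s
(x ·ℕ n) .disjoint {q} (l , xl , q<ln) (u , xu , un<q) with u ℚ.≤? l
... | yes u≤l with s , l<s , xs ← lower-rounded x xl =
  disjoint x xs (upper-closed x (ℚ.≤-<-trans u≤l l<s) xu)
... | no  u≰l = ℚ.<-irrefl refl
  (ℚ.<-trans q<ln (ℚ.≤-<-trans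
    (ℚ.*-monoʳ-≤-nonNeg (ℕ→ℚ n) {{ℚ.normalize-nonNeg n 1}} (ℚ.<⇒≤ (ℚ.≰⇒> u≰l))) un<q))
(x ·ℕ zero) .located {p} {q} p<q with p ℚ.<? 0ℚ
... | yes p<0 with l , xl ← lower-inhab x =
  inj₁ (l , xl , subst (p ℚ.<_) (sym (ℚ.*-zeroʳ l)) p<0)
... | no  p≮0 with u , xu ← upper-inhab x =
  inj₂ (u , xu , subst (ℚ._< q) (sym (ℚ.*-zeroʳ u)) (ℚ.≤-<-trans (ℚ.≮⇒≥ p≮0) p<q))
(x ·ℕ suc n) .located {p} {q} p<q
  with a , p<a , a<q ← ℚ.<-dense p<q
  with b , a<b , b<q ← ℚ.<-dense a<q
  with r , r>0 , cancel ← recip n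
  with located x (ℚ.*-monoˡ-<-pos r {{r>0}} a<b)
... | inj₁ xl = inj₁ (_ , xl , subst (p ℚ.<_) (sym (cancel a)) p<a)
... | inj₂ xu = inj₂ (_ , xu , subst (ℚ._< q) (sym (cancel b)) b<q)

-- The cut {q < √r} ∣ {√r < q}, for r ≥ 0; the interposed s makes it rounded.

√_ : ℚ → ℝ
(√ r) .lower q = ∃[ s ] q ℚ.< s × (s ℚ.≤ 0ℚ ⊎ s ℚ.* s ℚ.≤ r)
(√ r) .upper q = ∃[ s ] s ℚ.< q × 0ℚ ℚ.≤ s × r ℚ.≤ s ℚ.* s
(√ r) .lower-inhab = _ , 0ℚ , p-1<p 0ℚ , inj₁ ℚ.≤-refl
(√ r) .upper-inhab with r ℚ.≤? 1ℚ
... | yes r≤1 = _ , 1ℚ , p<p+1 1ℚ , ℚ.<⇒≤ 0<1 , r≤1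
... | no  r≰1 = _ , r , p<p+1 r , ℚ.<⇒≤ 0<r ,
  subst (ℚ._≤ r ℚ.* r) (ℚ.*-identityˡ r)
    (ℚ.*-monoʳ-≤-nonNeg r {{ℚ.nonNegative (ℚ.<⇒≤ 0<r)}} (ℚ.<⇒≤ (ℚ.≰⇒> r≰1)))
  where
  0<r : 0ℚ ℚ.< r
  0<r = ℚ.<-trans 0<1 (ℚ.≰⇒> r≰1)
(√ r) .lower-closed p<q (s , q<s , h) = s , ℚ.<-trans p<q q<s , h
(√ r) .upper-closed p<q (s , s<p , h) = s , ℚ.<-trans s<p p<q , h
(√ r) .lower-rounded (s , p<s , h) with t , p<t , t<s ← ℚ.<-dense p<s =
  t , p<t , s , t<s , h
(√ r) .upper-rounded (s , s<q , h) with t , s<t , t<q ← ℚ.<-dense s<q =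
  t , t<q , s , s<t , h
(√ r) .disjoint (s , q<s , inj₁ s≤0) (t , t<q , 0≤t , _) =
  ℚ.<-irrefl refl (ℚ.<-≤-trans (ℚ.≤-<-trans 0≤t (ℚ.<-trans t<q q<s)) s≤0)
(√ r) .disjoint (s , q<s , inj₂ s²≤r) (t , t<q , 0≤t , r≤t²) =
  ℚ.<-irrefl refl (ℚ.<-≤-trans t²<s² (ℚ.≤-trans s²≤r r≤t²))
  where
  t<s : t ℚ.< s
  t<s = ℚ.<-trans t<q q<s
  t²<s² : t ℚ.* t ℚ.< s ℚ.* s
  t²<s² = ℚ.≤-<-trans
    (ℚ.*-monoˡ-≤-nonNeg t {{ℚ.nonNegative 0≤t}} (ℚ.<⇒≤ t<s))
    (ℚ.*-monoˡ-<-pos s {{ℚ.positive (ℚ.≤-<-trans 0≤t t<s)}} t<s)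
(√ r) .located p<q with m , p<m , m<q ← ℚ.<-dense p<q with m ℚ.≤? 0ℚ
... | yes m≤0 = inj₁ (m , p<m , inj₁ m≤0)
... | no  m≰0 with m ℚ.* m ℚ.≤? r
...   | yes m²≤r = inj₁ (m , p<m , inj₂ m²≤r)
...   | no  m²≰r = inj₂ (m , m<q , ℚ.<⇒≤ (ℚ.≰⇒> m≰0) , ℚ.<⇒≤ (ℚ.≰⇒> m²≰r))

record FinSubset (A : Set) : Set where
  field
    elements : List A
    unique   : Unique elements

open FinSubset

module _ {A : Set} where

  infix 4 _∈ᶠ_ _⊆ᶠ_

  _∈ᶠ_ : A → FinSubset A → Set
  a ∈ᶠ X = a ListMembership.∈ elements X

  _⊆ᶠ_ : FinSubset A → FinSubset A → Set
  X ⊆ᶠ Y = ∀ {a} → a ∈ᶠ X → a ∈ᶠ Y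

  ∣_∣ : FinSubset A → ℕ
  ∣ X ∣ = length (elements X)

  ∣_∩_∣ : FinSubset A → {R : Pred A 0ℓ} → Decidable R → ℕ
  ∣ X ∩ R? ∣ = length (filter R? (elements X))

OddPrimePower : ℕ → Set
OddPrimePower q = (∃₂ λ p k → Prime p × 1 ℕ.≤ k × q ≡ p ℕ.^ k) × ¬ (2 ∣ q)

-- A Heyting field whose equality is _≡_ and whose apartness is _≢_ is a
-- field in the usual sense.

record FiniteField (q : ℕ) : Set₁ where
  infixl 6 _+_ _-_
  infixl 7 _*_ _/_
  infix  8 -_
  infix  4 _≟_
  field
    Carrier        : Set
    _+_ _*_        : Carrier → Carrier → Carrier
    -_             : Carrier → Carrier
    0# 1#          : Carrier
    isHeytingField : IsHeytingField _≡_ _≢_ _+_ _*_ -_ 0# 1#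
    enumeration    : Carrier ↔ Fin q

  open IsHeytingField isHeytingField public using (#⇒invertible)

  _-_ : Carrier → Carrier → Carrier
  x - y = x + - y

  _≟_ : DecidableEquality Carrier
  _≟_ = via-injection (↔⇒↣ enumeration) Fin._≟_

  -- Division is total, with x / 0# = 0#.
  _/_ : Carrier → Carrier → Carrier
  x / y with y ≟ 0#
  ... | yes _  = 0#
  ... | no y≢0 = x * proj₁ (#⇒invertible y≢0)

  2# : Carrier
  2# = 1# + 1#

  any? : {R : Pred Carrier 0ℓ} → Decidable R → Dec (∃ R)
  any? {R} R? = map′ (λ (i , r) → from i , r)
                     (λ (x , r) → to x , subst R (sym (strictlyInverseʳ x)) r)
                     (Fin.any? (R? ∘ from))
    where open Inverse enumeration

  anyVec? : ∀ {n} {R : Pred (Vec Carrier n) 0ℓ} → Decidable R → Dec (∃ R)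
  anyVec? {zero}  R? = map′ ([] ,_) (λ { ([] , r) → r }) (R? [])
  anyVec? {suc n} R? = map′ (λ (x , v , r) → x ∷ v , r)
                            (λ { (x ∷ v , r) → x , v , r })
                            (any? λ x → anyVec? λ v → R? (x ∷ v))

module VectorSpace {q : ℕ} (F : FiniteField q) where
  open FiniteField F

  𝔽^ : ℕ → Set
  𝔽^ n = Vec Carrier n

  infixl 6 _⊕_ _⊖_
  infixr 7 _•_

  _⊕_ _⊖_ : ∀ {n} → 𝔽^ n → 𝔽^ n → 𝔽^ n
  _⊕_ = zipWith _+_
  _⊖_ = zipWith _-_

  _•_ : ∀ {n} → Carrier → 𝔽^ n → 𝔽^ n
  a • v = Vec.map (a *_) v

  𝟎 : ∀ {n} → 𝔽^ n
  𝟎 = replicate _ 0#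

  _≟ᵛ_ : ∀ {n} → DecidableEquality (𝔽^ n)
  _≟ᵛ_ = ≡-dec _≟_

  combination : ∀ {n k} → 𝔽^ k → Vec (𝔽^ n) k → 𝔽^ n
  combination []       []       = 𝟎
  combination (a ∷ as) (v ∷ vs) = a • v ⊕ combination as vs

  LinearlyIndependent : ∀ {n k} → Vec (𝔽^ n) k → Set
  LinearlyIndependent vs = ∀ as → combination as vs ≡ 𝟎 → as ≡ 𝟎

  -- A nonempty affine subspace, given as a translate of the span of a basis
  -- of its direction space. Different records may describe the same set.
  record AffineSubspace (n : ℕ) : Set where
    field
      origin      : 𝔽^ n
      dim         : ℕ
      basis       : Vec (𝔽^ n) dim
      independent : LinearlyIndependent basis

  open AffineSubspace public

  infix 4 _∈ᵃ_ _∈ᵃ?_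

  _∈ᵃ_ : ∀ {n} → 𝔽^ n → AffineSubspace n → Set
  y ∈ᵃ A = ∃[ as ] y ≡ origin A ⊕ combination as (basis A)

  _∈ᵃ?_ : ∀ {n} (y : 𝔽^ n) (A : AffineSubspace n) → Dec (y ∈ᵃ A)
  y ∈ᵃ? A = anyVec? λ as → y ≟ᵛ (origin A ⊕ combination as (basis A))

  OnLineThrough : ∀ {n} → 𝔽^ n → 𝔽^ n → Pred (𝔽^ n) 0ℓ
  OnLineThrough y₀ y₁ y = ∃[ t ] y ≡ y₀ ⊕ t • (y₁ ⊖ y₀)

  polar : ∀ {n} → (𝔽^ n → Carrier) → 𝔽^ n → 𝔽^ n → Carrier
  polar Q x y = Q (x ⊕ y) - Q x - Q y

  -- The polar form is symmetric, so linearity in one argument suffices.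
  record QuadraticForm (n : ℕ) : Set where
    field
      ⟦_⟧           : 𝔽^ n → Carrier
      homogeneous   : ∀ a x → ⟦ a • x ⟧ ≡ a * a * ⟦ x ⟧
      polar-+       : ∀ x y z → polar ⟦_⟧ (x ⊕ y) z ≡ polar ⟦_⟧ x z + polar ⟦_⟧ y z
      polar-*       : ∀ a x z → polar ⟦_⟧ (a • x) z ≡ a * polar ⟦_⟧ x z

    ⟨_,_⟩ : 𝔽^ n → 𝔽^ n → Carrier
    ⟨ x , y ⟩ = polar ⟦_⟧ x y / 2#

    Nondegenerate : Set
    Nondegenerate = ∀ x → (∀ y → ⟨ x , y ⟩ ≡ 0#) → x ≡ 𝟎

module Spheres {q d : ℕ} (F : FiniteField q) (Q : VectorSpace.QuadraticForm F d) where
  open FiniteField F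
  open VectorSpace F
  open QuadraticForm Q

  Point Sphere : Set
  Point  = 𝔽^ d
  Sphere = 𝔽^ d × Carrier

  infix 4 _∈ˢ_ _∈ˢ?_

  _∈ˢ_ : Point → Sphere → Set
  x ∈ˢ (c , r) = ⟦ x ⊖ c ⟧ ≡ r

  _∈ˢ?_ : ∀ x S → Dec (x ∈ˢ S)
  x ∈ˢ? (c , r) = ⟦ x ⊖ c ⟧ ≟ r

  I : FinSubset Point → FinSubset Sphere → ℕ
  I P 𝒮 = length (filter (λ (x , S) → x ∈ˢ? S)
                         (cartesianProduct (elements P) (elements 𝒮)))

  μ : (P : FinSubset Point) (𝒮 : FinSubset Sphere) →
      .{{ℕ.NonZero ∣ P ∣}} → .{{ℕ.NonZero ∣ 𝒮 ∣}} → ℚ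
  μ P 𝒮 = 1ℚ ℚ.- (+ I P 𝒮 ℚ./ (∣ P ∣ ℕ.* ∣ 𝒮 ∣)) {{ℕ.m*n≢0 ∣ P ∣ ∣ 𝒮 ∣}}

  -- 𝔽^ d × 𝔽 is identified with 𝔽^ (suc d) by appending the last coordinate.

  Φ : Sphere → 𝔽^ (suc d)
  Φ (c , r) = (2# • c) ∷ʳ (r - ⟦ c ⟧)

  Λ : Point → 𝔽^ (suc d) → Carrier
  Λ x y = ⟦ x ⟧ - ⟨ x , init y ⟩ - last y

  𝒮⟨_⟩ : AffineSubspace (suc d) → Pred Sphere 0ℓ
  𝒮⟨ L ⟩ S = Φ S ∈ᵃ L

  B⟨_⟩ : AffineSubspace (suc d) → Pred Point 0ℓ
  B⟨ L ⟩ x = ∀ y → y ∈ᵃ L → Λ x y ≡ 0#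

  record IsCoaxalPencil (C : Pred Sphere 0ℓ) : Set where
    field
      S₀ S₁         : Sphere
      distinct      : S₀ ≢ S₁
      lifts-on-line : ∀ y → (∃[ S ] C S × Φ S ≡ y) ⇔ OnLineThrough (Φ S₀) (Φ S₁) y
      members       : FinSubset Sphere
      q-members     : ∣ members ∣ ≡ q
      is-members    : ∀ S → C S ⇔ S ∈ᶠ members

  record Classifies (P : FinSubset Point) (𝒮 : FinSubset Sphere) (δ : ℝ)
                    (L : AffineSubspace (suc d)) : Set where
    field
      P₀       : FinSubset Point
      𝒮₀       : FinSubset Sphere
      P₀⊆P     : P₀ ⊆ᶠ P
      P₀⊆B⟨L⟩  : ∀ {x} → x ∈ᶠ P₀ → B⟨ L ⟩ x
      𝒮₀⊆𝒮     : 𝒮₀ ⊆ᶠ 𝒮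
      𝒮₀⊆𝒮⟨L⟩  : ∀ {S} → S ∈ᶠ 𝒮₀ → 𝒮⟨ L ⟩ S
      P₀-large : ℕ→ℝ ∣ P₀ ∣ ≥ℝ (1- δ) ·ℕ ∣ P ∣
      𝒮₀-large : ℕ→ℝ ∣ 𝒮₀ ∣ ≥ℝ (1- δ) ·ℕ ∣ 𝒮 ∣

{-# OPTIONS --safe #-}

-- Write m = |P|, n = |𝒮|, D = d + 1, and let E = μ m n be the number of
-- non-incidences. Build L as the affine span of the lifts of successively
-- chosen spheres. As long as more than δ n spheres lift outside L, some such
-- sphere misses at most E / (δ n) = δ m / D points of P; choose it. Each choice
-- raises dim L, and D + 1 choices lose at most (D + 1) δ m / D < m points, which
-- is what μ < D / (D + 1)² says. So P ∩ B(L) stays nonempty; as a nonempty B(L)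
-- forces dim L ≤ d, there are at most D choices and at most δ m points are lost.
--
-- If dim L ≥ 2, two independent directions of L give two independent linear
-- equations satisfied on B(L), so that B(L) lies in a flat of codimension two,
-- which contradicts δ < γ.
module Submission where

open import Defs
open import Level using (0ℓ)
import Algebra.Apartness.Structures as Apartness
open import Algebra.Bundles using (CommutativeRing)
open import Algebra.Properties.Group using (⁻¹-involutive; //-rightDividesʳ)
import Algebra.Properties.Ring as RingProperties
import Algebra.Properties.Semiring.Mult.TCOptimised as Multiples
import Algebra.Solver.Ring as RingSolver
open import Algebra.Solver.Ring.AlmostCommutativeRing
  using (_-Raw-AlmostCommutative⟶_; fromCommutativeRing)
open import Data.Empty using (⊥)
open import Data.Integer.Base as ℤ using (ℤ; -[1+_])
import Data.Integer.Properties as ℤ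
open import Data.List.Base using (List; []; _∷_; _++_; length; map; filter; cartesianProduct; allFin)
import Data.List.Extrema.Nat as Extrema
open import Data.List.Membership.Propositional using (_∈_)
open import Data.List.Membership.Propositional.Properties
  using (∈-∃++; ∈-++⁻; ∈-++⁺ˡ; ∈-++⁺ʳ; ∈-map⁺; ∈-map⁻; ∈-allFin; ∈-filter⁺; ∈-filter⁻
        ; ∈-cartesianProduct⁺; ∈-cartesianProduct⁻)
open import Data.List.Properties using (length-++; length-++-sucʳ; length-map; length-tabulate; filter-++)
import Data.List.Relation.Unary.All as All
open import Data.List.Relation.Unary.AllPairs using (_∷_)
open import Data.List.Relation.Unary.Any using (here; there)
open import Data.List.Relation.Unary.Unique.Propositional using (Unique)
import Data.List.Relation.Unary.Unique.Propositional.Properties as Unique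
open import Data.Maybe.Base using (just; nothing)
open import Data.Nat.Base as ℕ using (ℕ; zero; suc; _≤_; _<_; z≤n; s≤s; NonZero)
import Data.Nat.Properties as ℕ
open import Data.Nat.Solver using (module +-*-Solver)
open import Data.Product.Base using (∃; ∃-syntax; ∃₂; _×_; _,_; proj₁; proj₂; swap; uncurry)
open import Data.Rational.Base as ℚ using (ℚ; 0ℚ; 1ℚ; toℚᵘ)
import Data.Rational.Properties as ℚ
open import Data.Rational.Unnormalised.Base as ℚᵘ using (mkℚᵘ; *≡*; *≤*; *<*)
import Data.Rational.Unnormalised.Properties as ℚᵘ
open import Data.Sum.Base using (inj₁; inj₂; [_,_]′)
open import Data.Vec.Base as Vec using (Vec; []; _∷_; _∷ʳ_; init; last; head; tail)
open import Data.Vec.Properties using (init-∷ʳ; last-∷ʳ; ∷-injectiveˡ; ∷-injectiveʳ)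
open import Function.Base using (id; _∘_; flip)
open import Function.Bundles using (_⇔_; mk⇔; module Inverse)
open import Relation.Binary.Core using (REL)
import Relation.Binary.Definitions as B
open import Relation.Binary.PropositionalEquality
open import Relation.Nullary using (¬_; Dec; yes; no; ¬?; contradiction; decidable-stable)
open import Relation.Unary using (Pred; Decidable)

-- Linear algebra over a finite field

-- Since δ is a square root, it need not be rational, so the construction itself compares no real
-- numbers. With δ² = D E / (m n), the test T > δ n on a number T of spheres becomes D E n < T² m,
-- and the bound e ≤ δ m / D on a loss becomes (D e)² n ≤ D E m. Both are decidable statements about
-- natural numbers; Dedekind cuts enter only when final sizes are compared with (1 - δ) m and (1 -
-- δ) n.
--
-- Why a point x of B(L) bounds the dimension: Λ_x is affine in y, with linear part -(⟨x, u⟩ + a).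
-- On directions (u, a) of L this part vanishes, so u determines a and the projection to u is
-- injective on directions. This gives dim L ≤ d. It also makes the u-parts of two independent
-- directions independent, and nondegeneracy turns these into independent functionals ⟨·, u⟩, whose
-- values on B(L) are fixed.

module FieldArithmetic {q : ℕ} (F : FiniteField q) where
  open FiniteField F
  private module F = Apartness.IsHeytingField isHeytingField

  commutativeRing : CommutativeRing 0ℓ 0ℓ
  commutativeRing = record { isCommutativeRing = F.isCommutativeRing }

  open CommutativeRing commutativeRing public
    using (+-identityʳ; +-identityˡ; *-identityʳ; *-identityˡ; zeroˡ; zeroʳ; -‿inverseʳ
          ; *-comm; *-assoc; +-comm; +-assoc)
  open RingProperties (CommutativeRing.ring commutativeRing) public
    using (-0#≈0#)

  private
    module R = CommutativeRing commutativeRing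
    open RingProperties R.ring using (-‿distribˡ-*; -‿involutive; -‿+-comm)
    open Multiples R.semiring using (×-homo-+; ×1-homo-*; 1+×) renaming (_×_ to _·_)

    fromℤ : ℤ → Carrier
    fromℤ (ℤ.+ n)  = n · 1#
    fromℤ -[1+ n ] = - (suc n · 1#)

    fromℤ-neg : ∀ i → fromℤ (ℤ.- i) ≡ - fromℤ i
    fromℤ-neg (ℤ.+ zero)  = sym -0#≈0#
    fromℤ-neg (ℤ.+ suc n) = refl
    fromℤ-neg -[1+ n ]    = sym (-‿involutive _)

    cancel-1 : ∀ a b → (1# + a) - (1# + b) ≡ a - b
    cancel-1 a b = begin
      (1# + a) - (1# + b)      ≡⟨ cong ((1# + a) +_) (sym (-‿+-comm 1# b)) ⟩
      (1# + a) + (- 1# + - b)  ≡⟨ R.+-assoc (1# + a) (- 1#) (- b) ⟨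
      ((1# + a) - 1#) - b      ≡⟨ cong (_- b) (cong (_- 1#) (R.+-comm 1# a)) ⟩
      ((a + 1#) - 1#) - b      ≡⟨ cong (_- b) (R.+-assoc a 1# (- 1#)) ⟩
      (a + (1# - 1#)) - b      ≡⟨ cong (_- b) (cong (a +_) (R.-‿inverseʳ 1#)) ⟩
      (a + 0#) - b             ≡⟨ cong (_- b) (R.+-identityʳ a) ⟩
      a - b                    ∎
      where open ≡-Reasoning

    fromℤ-⊖ : ∀ m n → fromℤ (m ℤ.⊖ n) ≡ m · 1# - n · 1#
    fromℤ-⊖ zero    zero    = sym (R.-‿inverseʳ 0#)
    fromℤ-⊖ zero    (suc n) = sym (R.+-identityˡ _)
    fromℤ-⊖ (suc m) zero    = sym (trans (cong (suc m · 1# +_) -0#≈0#) (R.+-identityʳ _))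
    fromℤ-⊖ (suc m) (suc n) = begin
      fromℤ (suc m ℤ.⊖ suc n)            ≡⟨ cong fromℤ (ℤ.[1+m]⊖[1+n]≡m⊖n m n) ⟩
      fromℤ (m ℤ.⊖ n)                    ≡⟨ fromℤ-⊖ m n ⟩
      m · 1# - n · 1#                    ≡⟨ cancel-1 (m · 1#) (n · 1#) ⟨
      (1# + m · 1#) - (1# + n · 1#)      ≡⟨ cong₂ _-_ (1+× m 1#) (1+× n 1#) ⟨
      suc m · 1# - suc n · 1#            ∎
      where open ≡-Reasoning

    fromℤ-+ : ∀ i j → fromℤ (i ℤ.+ j) ≡ fromℤ i + fromℤ j
    fromℤ-+ (ℤ.+ m)  (ℤ.+ n)  = ×-homo-+ 1# m n
    fromℤ-+ (ℤ.+ m)  -[1+ n ] = fromℤ-⊖ m (suc n)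
    fromℤ-+ -[1+ m ] (ℤ.+ n)  = trans (fromℤ-⊖ n (suc m)) (R.+-comm _ _)
    fromℤ-+ -[1+ m ] -[1+ n ] = trans
      (cong -_ (trans (cong (λ k → suc k · 1#) (sym (ℕ.+-suc m n))) (×-homo-+ 1# (suc m) (suc n))))
      (sym (-‿+-comm _ _))

    fromℤ-+* : ∀ m j → fromℤ (ℤ.+ m ℤ.* j) ≡ fromℤ (ℤ.+ m) * fromℤ j
    fromℤ-+* m (ℤ.+ n)  = trans (cong fromℤ (sym (ℤ.pos-* m n))) (×1-homo-* m n)
    fromℤ-+* m -[1+ n ] = begin
      fromℤ (ℤ.+ m ℤ.* -[1+ n ])             ≡⟨ cong fromℤ (ℤ.neg-distribʳ-* (ℤ.+ m) (ℤ.+ suc n)) ⟨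
      fromℤ (ℤ.- (ℤ.+ m ℤ.* ℤ.+ suc n))      ≡⟨ fromℤ-neg (ℤ.+ m ℤ.* ℤ.+ suc n) ⟩
      - fromℤ (ℤ.+ m ℤ.* ℤ.+ suc n)          ≡⟨ cong -_ (fromℤ-+* m (ℤ.+ suc n)) ⟩
      - (fromℤ (ℤ.+ m) * fromℤ (ℤ.+ suc n))  ≡⟨ RingProperties.-‿distribʳ-* R.ring _ _ ⟩
      fromℤ (ℤ.+ m) * fromℤ -[1+ n ]         ∎
      where open ≡-Reasoning

    fromℤ-* : ∀ i j → fromℤ (i ℤ.* j) ≡ fromℤ i * fromℤ j
    fromℤ-* (ℤ.+ m)  j = fromℤ-+* m j
    fromℤ-* -[1+ m ] j = begin
      fromℤ (-[1+ m ] ℤ.* j)           ≡⟨ cong fromℤ (ℤ.neg-distribˡ-* (ℤ.+ suc m) j) ⟨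
      fromℤ (ℤ.- (ℤ.+ suc m ℤ.* j))    ≡⟨ fromℤ-neg (ℤ.+ suc m ℤ.* j) ⟩
      - fromℤ (ℤ.+ suc m ℤ.* j)        ≡⟨ cong -_ (fromℤ-+* (suc m) j) ⟩
      - (fromℤ (ℤ.+ suc m) * fromℤ j)  ≡⟨ -‿distribˡ-* _ _ ⟩
      fromℤ -[1+ m ] * fromℤ j         ∎
      where open ≡-Reasoning

    fromℤ-morphism : ℤ.+-*-rawRing -Raw-AlmostCommutative⟶ fromCommutativeRing commutativeRing
    fromℤ-morphism = record
      { ⟦_⟧ = fromℤ ; +-homo = fromℤ-+ ; *-homo = fromℤ-* ; -‿homo = fromℤ-neg
      ; 0-homo = refl ; 1-homo = refl }

    coefficients≟ : B.WeaklyDecidable (λ i j → fromℤ i ≡ fromℤ j)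
    coefficients≟ i j with i ℤ.≟ j
    ... | yes refl = just refl
    ... | no  _    = nothing

  -- Integer coefficients let the solver cancel terms of opposite sign, which
  -- the undecided closed terms of an abstract field do not.
  open RingSolver ℤ.+-*-rawRing (fromCommutativeRing commutativeRing) fromℤ-morphism coefficients≟
    public using (solve; con; _:+_; _:*_; _:-_; :-_; _:=_)

  -- The field axioms tie apartness of x and y to invertibility of x - y, so the inverse of 1 has to
  -- be read as an inverse of 1 - 0; `inverse` rewrites y - 0 in the same way.
  1≢0 : 1# ≢ 0#
  1≢0 = F.invertible⇒# (1# , trans (*-identityˡ _) 1-0 , trans (*-identityʳ _) 1-0)
    where
    1-0 : 1# - 0# ≡ 1#
    1-0 = solve 0 (con (ℤ.+ 1) :- con (ℤ.+ 0) := con (ℤ.+ 1)) refl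

  inverse : ∀ {y} → y ≢ 0# → ∃[ z ] y * z ≡ 1#
  inverse {y} y≢0 with z , _ , yz≡1 ← #⇒invertible y≢0 =
    z , trans (cong (_* z) (solve 1 (λ y → y := y :- con (ℤ.+ 0)) refl y)) yz≡1

  -- One factor z serves every numerator, so division by a fixed nonzero y inherits linearity from
  -- multiplication.
  /-inverse : ∀ {y} → y ≢ 0# → ∃[ z ] y * z ≡ 1# × (∀ x → x / y ≡ x * z)
  /-inverse {y} y≢0 with y ≟ 0#
  ... | yes y≡0  = contradiction y≡0 y≢0
  ... | no  y≢0′ = _ , proj₂ (inverse y≢0′) , λ _ → refl

module LinearAlgebra {q : ℕ} (F : FiniteField q) where
  open FiniteField F
  open FieldArithmetic F
  open VectorSpace F

  ⊕-identityˡ : ∀ {n} (x : 𝔽^ n) → 𝟎 ⊕ x ≡ x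
  ⊕-identityˡ []      = refl
  ⊕-identityˡ (x ∷ v) = cong₂ _∷_ (+-identityˡ x) (⊕-identityˡ v)

  ⊕-identityʳ : ∀ {n} (x : 𝔽^ n) → x ⊕ 𝟎 ≡ x
  ⊕-identityʳ []      = refl
  ⊕-identityʳ (x ∷ v) = cong₂ _∷_ (+-identityʳ x) (⊕-identityʳ v)

  ⊕-assoc : ∀ {n} (x y z : 𝔽^ n) → (x ⊕ y) ⊕ z ≡ x ⊕ (y ⊕ z)
  ⊕-assoc []      []      []      = refl
  ⊕-assoc (x ∷ u) (y ∷ v) (z ∷ w) = cong₂ _∷_ (+-assoc x y z) (⊕-assoc u v w)

  ⊕-comm : ∀ {n} (x y : 𝔽^ n) → x ⊕ y ≡ y ⊕ x
  ⊕-comm []      []      = refl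
  ⊕-comm (x ∷ u) (y ∷ v) = cong₂ _∷_ (+-comm x y) (⊕-comm u v)

  ⊕-⊖-cancel : ∀ {n} (x y : 𝔽^ n) → x ⊕ (y ⊖ x) ≡ y
  ⊕-⊖-cancel []      []      = refl
  ⊕-⊖-cancel (x ∷ u) (y ∷ v) = cong₂ _∷_
    (solve 2 (λ x y → x :+ (y :- x) := y) refl x y) (⊕-⊖-cancel u v)

  ⊖-as-⊕ : ∀ {n} (x y : 𝔽^ n) → x ⊖ y ≡ x ⊕ (- 1#) • y
  ⊖-as-⊕ []      []      = refl
  ⊖-as-⊕ (x ∷ u) (y ∷ v) = cong₂ _∷_
    (solve 2 (λ x y → x :- y := x :+ (:- con (ℤ.+ 1)) :* y) refl x y) (⊖-as-⊕ u v)

  •-zeroˡ : ∀ {n} (x : 𝔽^ n) → 0# • x ≡ 𝟎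
  •-zeroˡ []      = refl
  •-zeroˡ (x ∷ v) = cong₂ _∷_ (zeroˡ x) (•-zeroˡ v)

  •-zeroʳ : ∀ {n} a → a • 𝟎 {n} ≡ 𝟎
  •-zeroʳ {zero}  a = refl
  •-zeroʳ {suc n} a = cong₂ _∷_ (zeroʳ a) (•-zeroʳ a)

  •-identityˡ : ∀ {n} (x : 𝔽^ n) → 1# • x ≡ x
  •-identityˡ []      = refl
  •-identityˡ (x ∷ v) = cong₂ _∷_ (*-identityˡ x) (•-identityˡ v)

  •-assoc : ∀ {n} a b (x : 𝔽^ n) → (a * b) • x ≡ a • (b • x)
  •-assoc a b []      = refl
  •-assoc a b (x ∷ v) = cong₂ _∷_ (*-assoc a b x) (•-assoc a b v)

  •-distribˡ : ∀ {n} a (x y : 𝔽^ n) → a • (x ⊕ y) ≡ a • x ⊕ a • y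
  •-distribˡ a []      []      = refl
  •-distribˡ a (x ∷ u) (y ∷ v) = cong₂ _∷_
    (solve 3 (λ a x y → a :* (x :+ y) := a :* x :+ a :* y) refl a x y) (•-distribˡ a u v)

  combination-𝟎 : ∀ {n k} (vs : Vec (𝔽^ n) k) → combination 𝟎 vs ≡ 𝟎
  combination-𝟎 []       = refl
  combination-𝟎 (v ∷ vs) =
    trans (cong₂ _⊕_ (•-zeroˡ v) (combination-𝟎 vs)) (⊕-identityˡ 𝟎)

  combination-• : ∀ {n k} a (as : 𝔽^ k) (vs : Vec (𝔽^ n) k) →
                  combination (a • as) vs ≡ a • combination as vs
  combination-• a []       []       = sym (•-zeroʳ a)
  combination-• a (b ∷ as) (v ∷ vs) =
    trans (cong₂ _⊕_ (•-assoc a b v) (combination-• a as vs)) (sym (•-distribˡ a (b • v) _))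

  -- Linear functionals and Gaussian elimination

  record IsLinear {n} (φ : 𝔽^ n → Carrier) : Set where
    field
      +-homo : ∀ x y → φ (x ⊕ y) ≡ φ x + φ y
      *-homo : ∀ a x → φ (a • x) ≡ a * φ x

    0-homo : φ 𝟎 ≡ 0#
    0-homo = trans (cong φ (sym (•-zeroˡ 𝟎))) (trans (*-homo 0# 𝟎) (zeroˡ (φ 𝟎)))

    combination-∷ : ∀ {k} a (as : 𝔽^ k) v vs →
                    φ (combination (a ∷ as) (v ∷ vs)) ≡ a * φ v + φ (combination as vs)
    combination-∷ a as v vs = trans (+-homo _ _) (cong (_+ φ (combination as vs)) (*-homo a v))

    ⊖-homo : ∀ x a v → φ (x ⊖ a • v) ≡ φ x - a * φ v
    ⊖-homo x a v = begin
      φ (x ⊖ a • v)             ≡⟨ cong φ (⊖-as-⊕ x (a • v)) ⟩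
      φ (x ⊕ (- 1#) • a • v)    ≡⟨ +-homo x _ ⟩
      φ x + φ ((- 1#) • a • v)  ≡⟨ cong (φ x +_) (trans (*-homo _ _) (cong (- 1# *_) (*-homo a v))) ⟩
      φ x + - 1# * (a * φ v)    ≡⟨ solve 2 (λ x y → x :+ (:- con (ℤ.+ 1)) :* y := x :- y) refl (φ x) (a * φ v) ⟩
      φ x - a * φ v             ∎
      where open ≡-Reasoning

  independent-tail : ∀ {n k} {v : 𝔽^ n} {vs : Vec (𝔽^ n) k} →
                     LinearlyIndependent (v ∷ vs) → LinearlyIndependent vs
  independent-tail {v = v} {vs} li as as·vs≡𝟎 =
    ∷-injectiveʳ (li (0# ∷ as) (trans (cong₂ _⊕_ (•-zeroˡ v) as·vs≡𝟎) (⊕-identityˡ 𝟎)))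

  -- One round of Gaussian elimination: the span of `vs` splits into the line of a vector outside
  -- ker φ and the part of the span inside ker φ, with basis `kernel`.
  record Elimination {n k} (φ : 𝔽^ n → Carrier) (vs : Vec (𝔽^ n) (suc k)) : Set where
    field
      pivot              : 𝔽^ n
      pivot≢0            : φ pivot ≢ 0#
      kernel             : Vec (𝔽^ n) k
      kernel-independent : LinearlyIndependent kernel
      kernel-vanishes    : ∀ as → φ (combination as kernel) ≡ 0#
      kernel⊆span        : ∀ as → ∃[ bs ] combination as kernel ≡ combination bs vs
      decompose          : ∀ as → ∃₂ λ a bs →
                           combination as vs ≡ a • pivot ⊕ combination bs kernel

  -- Each sheared vector differs from the original one by a multiple of `v`, hence so do their
  -- combinations.
  combination-shear : ∀ {n k} (c : 𝔽^ n → Carrier) (v : 𝔽^ n) (ws : Vec (𝔽^ n) k) as →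
    ∃[ t ] combination as (Vec.map (λ w → w ⊖ c w • v) ws) ≡ t • v ⊕ combination as ws
  combination-shear c v []       []       =
    0# , sym (trans (cong (_⊕ 𝟎) (•-zeroˡ v)) (⊕-identityˡ 𝟎))
  combination-shear c v (w ∷ ws) (a ∷ as) with t , eq ← combination-shear c v ws as =
    - (a * c w) + t , trans (cong (a • (w ⊖ c w • v) ⊕_) eq) (rearrange (c w) w v _)
    where
    rearrange : ∀ {n} b (w v r : 𝔽^ n) →
                a • (w ⊖ b • v) ⊕ (t • v ⊕ r) ≡ (- (a * b) + t) • v ⊕ (a • w ⊕ r)
    rearrange b []      []      []      = refl
    rearrange b (w ∷ ws) (v ∷ vs) (r ∷ rs) = cong₂ _∷_
      (solve 6 (λ a b t w v r → a :* (w :- b :* v) :+ (t :* v :+ r)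
                                := (:- (a :* b) :+ t) :* v :+ (a :* w :+ r))
             refl a b t w v r)
      (rearrange b ws vs rs)

  -- If φ v ≠ 0, then `v` is the pivot and a shear along `v` moves the other vectors into ker φ. If
  -- φ v = 0, then `v` joins the kernel and the pivot is sought in the tail, where φ still takes a
  -- nonzero value.
  eliminate : ∀ {n k} {φ : 𝔽^ n → Carrier} → IsLinear φ →
              (vs : Vec (𝔽^ n) (suc k)) → LinearlyIndependent vs →
              ∀ as → φ (combination as vs) ≢ 0# → Elimination φ vs
  eliminate {n} {k} {φ} lin (v ∷ vs) li (a ∷ as) nonzero with φ v ≟ 0#
  ... | no  φv≢0 = record
    { pivot              = v
    ; pivot≢0            = φv≢0
    ; kernel             = sheared
    ; kernel-independent = λ bs bs·sheared≡𝟎 →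
        let t , eq = combination-shear c v vs bs in
        ∷-injectiveʳ (li (t ∷ bs) (trans (sym eq) bs·sheared≡𝟎))
    ; kernel-vanishes    = vanishes vs
    ; kernel⊆span        = λ bs → let t , eq = combination-shear c v vs bs in t ∷ bs , eq
    -- The shear already contributes t copies of `v`, so the pivot gets b - t.
    ; decompose          = λ { (b ∷ bs) → let t , eq = combination-shear c v vs bs in
        b - t , bs , sym (trans (cong ((b - t) • v ⊕_) eq) (cancel b t v (combination bs vs))) }
    }
    where
    open IsLinear lin
    z = proj₁ (inverse φv≢0)
    φv*z≡1 = proj₂ (inverse φv≢0)

    -- The quotient φ w / φ v: removing this multiple of `v` puts `w` into ker φ.
    c : 𝔽^ n → Carrier
    c w = φ w * z

    sheared : Vec (𝔽^ n) k
    sheared = Vec.map (λ w → w ⊖ c w • v) vs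

    shear∈ker : ∀ w → φ (w ⊖ c w • v) ≡ 0#
    shear∈ker w = begin
      φ (w ⊖ c w • v)          ≡⟨ ⊖-homo w (c w) v ⟩
      φ w - φ w * z * φ v      ≡⟨ solve 3 (λ w z v → w :- w :* z :* v := w :* (con (ℤ.+ 1) :- v :* z)) refl (φ w) z (φ v) ⟩
      φ w * (1# - φ v * z)     ≡⟨ cong (λ e → φ w * (1# - e)) φv*z≡1 ⟩
      φ w * (1# - 1#)          ≡⟨ solve 1 (λ w → w :* (con (ℤ.+ 1) :- con (ℤ.+ 1)) := con (ℤ.+ 0)) refl (φ w) ⟩
      0#                       ∎
      where open ≡-Reasoning

    vanishes : ∀ {m} (ws : Vec (𝔽^ n) m) bs →
               φ (combination bs (Vec.map (λ w → w ⊖ c w • v) ws)) ≡ 0#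
    vanishes []       []       = 0-homo
    vanishes (w ∷ ws) (b ∷ bs) = begin
      φ (combination (b ∷ bs) (Vec.map (λ w → w ⊖ c w • v) (w ∷ ws)))
        ≡⟨ combination-∷ b bs _ _ ⟩
      b * φ (w ⊖ c w • v) + φ (combination bs (Vec.map (λ w → w ⊖ c w • v) ws))
        ≡⟨ cong₂ _+_ (trans (cong (b *_) (shear∈ker w)) (zeroʳ b)) (vanishes ws bs) ⟩
      0# + 0#
        ≡⟨ +-identityˡ 0# ⟩
      0# ∎
      where open ≡-Reasoning

    cancel : ∀ {m} b t (v r : 𝔽^ m) → (b - t) • v ⊕ (t • v ⊕ r) ≡ b • v ⊕ r
    cancel b t []      []      = refl
    cancel b t (v ∷ vs) (r ∷ rs) = cong₂ _∷_
      (solve 4 (λ b t v r → (b :- t) :* v :+ (t :* v :+ r) := b :* v :+ r) refl b t v r)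
      (cancel b t vs rs)
  eliminate {n} {k} {φ} lin (v ∷ vs) li (a ∷ as) nonzero | yes φv≡0 = extend vs li as nonzero′
    where
    open IsLinear lin
    nonzero′ : φ (combination as vs) ≢ 0#
    nonzero′ eq = nonzero (begin
      φ (combination (a ∷ as) (v ∷ vs))  ≡⟨ combination-∷ a as v vs ⟩
      a * φ v + φ (combination as vs)    ≡⟨ cong₂ _+_ (trans (cong (a *_) φv≡0) (zeroʳ a)) eq ⟩
      0# + 0#                            ≡⟨ +-identityˡ 0# ⟩
      0#                                 ∎)
      where open ≡-Reasoning

    -- Splitting `vs` shows that the tail is nonempty, as the recursive call requires; over an empty
    -- tail φ would be evaluated at 𝟎 only.
    extend : ∀ {k} (vs : Vec (𝔽^ n) k) → LinearlyIndependent (v ∷ vs) →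
             ∀ as → φ (combination as vs) ≢ 0# → Elimination φ (v ∷ vs)
    extend []         li []  nonzero = contradiction 0-homo nonzero
    extend vs@(_ ∷ _) li as nonzero = record
      { pivot              = pivot
      ; pivot≢0            = pivot≢0
      ; kernel             = v ∷ kernel
      -- The kernel of the tail lies in the span of `vs`, so independence of `v ∷ vs` first forces b
      -- = 0; the rest is independence of the smaller kernel.
      ; kernel-independent = λ { (b ∷ bs) eq →
          let bs′ , eq′ = kernel⊆span bs
              b≡0 = ∷-injectiveˡ (li (b ∷ bs′) (trans (cong (b • v ⊕_) (sym eq′)) eq))
          in cong₂ _∷_ b≡0 (kernel-independent bs (begin
            combination bs kernel           ≡⟨ ⊕-identityˡ _ ⟨
            𝟎 ⊕ combination bs kernel       ≡⟨ cong (_⊕ combination bs kernel) (•-zeroˡ v) ⟨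
            0# • v ⊕ combination bs kernel  ≡⟨ cong (λ e → e • v ⊕ combination bs kernel) b≡0 ⟨
            b • v ⊕ combination bs kernel   ≡⟨ eq ⟩
            𝟎                               ∎)) }
      ; kernel-vanishes    = λ { (b ∷ bs) → begin
          φ (combination (b ∷ bs) (v ∷ kernel))  ≡⟨ combination-∷ b bs v kernel ⟩
          b * φ v + φ (combination bs kernel)
            ≡⟨ cong₂ _+_ (trans (cong (b *_) φv≡0) (zeroʳ b)) (kernel-vanishes bs) ⟩
          0# + 0#                                ≡⟨ +-identityˡ 0# ⟩
          0#                                     ∎ }
      ; kernel⊆span        = λ { (b ∷ bs) →
          let bs′ , eq = kernel⊆span bs in b ∷ bs′ , cong (b • v ⊕_) eq }
      ; decompose          = λ { (b ∷ bs) →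
          let a , cs , eq = decompose bs in
          a , b ∷ cs , (begin
            b • v ⊕ combination bs vs
              ≡⟨ cong (b • v ⊕_) eq ⟩
            b • v ⊕ (a • pivot ⊕ combination cs kernel)
              ≡⟨ ⊕-swap (b • v) (a • pivot) _ ⟩
            a • pivot ⊕ (b • v ⊕ combination cs kernel) ∎) }
      }
      where
      open Elimination (eliminate lin vs (independent-tail li) as nonzero)
      open ≡-Reasoning
      ⊕-swap : ∀ {m} (x y z : 𝔽^ m) → x ⊕ (y ⊕ z) ≡ y ⊕ (x ⊕ z)
      ⊕-swap []       []       []       = refl
      ⊕-swap (x ∷ xs) (y ∷ ys) (z ∷ zs) = cong₂ _∷_
        (solve 3 (λ x y z → x :+ (y :+ z) := y :+ (x :+ z)) refl x y z) (⊕-swap xs ys zs)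

  head-linear : ∀ {n} → IsLinear {suc n} head
  head-linear = record
    { +-homo = λ { (_ ∷ _) (_ ∷ _) → refl } ; *-homo = λ { _ (_ ∷ _) → refl } }

  combination-tail : ∀ {n k} (as : 𝔽^ k) (vs : Vec (𝔽^ (suc n)) k) →
                     combination as (Vec.map tail vs) ≡ tail (combination as vs)
  combination-tail []       []             = refl
  combination-tail (a ∷ as) ((x ∷ v) ∷ vs) with combination as vs | combination-tail as vs
  ... | _ ∷ _ | eq = cong (a • v ⊕_) eq

  independent-tails : ∀ {n k} (vs : Vec (𝔽^ (suc n)) k) → LinearlyIndependent vs →
                      (∀ as → head (combination as vs) ≡ 0#) →
                      LinearlyIndependent (Vec.map tail vs)
  independent-tails vs li heads≡0 as eq =
    li as (head-tail (combination as vs) (heads≡0 as) (trans (sym (combination-tail as vs)) eq))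
    where
    head-tail : ∀ {n} (x : 𝔽^ (suc n)) → head x ≡ 0# → tail x ≡ 𝟎 → x ≡ 𝟎
    head-tail (_ ∷ _) = cong₂ _∷_

  -- Induction on the number of coordinates. If some combination has a nonzero first coordinate,
  -- elimination spends one vector on it and the others have independent tails; otherwise all first
  -- coordinates vanish and all tails are independent.
  independent⇒≤ : ∀ {n k} (vs : Vec (𝔽^ n) k) → LinearlyIndependent vs → k ≤ n
  independent⇒≤ {n}     {zero}  vs li = z≤n
  -- All vectors of length 0 are equal, so the combination with leading coefficient 1 vanishes,
  -- against independence.
  independent⇒≤ {zero}  {suc k} vs li = contradiction (∷-injectiveˡ (li (1# ∷ 𝟎) []≡[])) 1≢0
    where
    []≡[] : combination (1# ∷ 𝟎) vs ≡ []
    []≡[] with [] ← combination (1# ∷ 𝟎) vs = refl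
  independent⇒≤ {suc n} {suc k} vs li with anyVec? (λ as → ¬? (head (combination as vs) ≟ 0#))
  ... | yes (as , nonzero) = s≤s (independent⇒≤ _ (independent-tails kernel kernel-independent kernel-vanishes))
    where open Elimination (eliminate head-linear vs li as nonzero)
  ... | no  vanishes = ℕ.m≤n⇒m≤1+n (independent⇒≤ _ (independent-tails vs li λ as →
    decidable-stable (_ ≟ 0#) λ ≢0 → vanishes (as , ≢0)))

  standardBasis : ∀ n → Vec (𝔽^ n) n
  standardBasis zero    = []
  standardBasis (suc n) = (1# ∷ 𝟎) ∷ Vec.map (0# ∷_) (standardBasis n)

  combination-standardBasis : ∀ {n} (as : 𝔽^ n) → combination as (standardBasis n) ≡ as
  combination-standardBasis []       = refl
  combination-standardBasis {suc n} (a ∷ as) = begin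
    a • (1# ∷ 𝟎) ⊕ combination as (Vec.map (0# ∷_) (standardBasis n))
      ≡⟨ cong (a • (1# ∷ 𝟎) ⊕_) (combination-0∷ as (standardBasis n)) ⟩
    (a * 1# + 0#) ∷ (a • 𝟎 ⊕ combination as (standardBasis n))
      ≡⟨ cong₂ _∷_ (trans (+-identityʳ _) (*-identityʳ a))
           (trans (cong₂ _⊕_ (•-zeroʳ a) (combination-standardBasis as)) (⊕-identityˡ as)) ⟩
    a ∷ as ∎
    where
    open ≡-Reasoning
    combination-0∷ : ∀ {n k} (as : 𝔽^ k) (vs : Vec (𝔽^ n) k) →
                     combination as (Vec.map (0# ∷_) vs) ≡ 0# ∷ combination as vs
    combination-0∷ []       []       = refl
    combination-0∷ (a ∷ as) (v ∷ vs) = trans (cong (a • (0# ∷ v) ⊕_) (combination-0∷ as vs))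
      (cong (_∷ (a • v ⊕ combination as vs)) (trans (+-identityʳ _) (zeroʳ a)))

  -- Affine subspaces and their hyperplane sections

  wholeSpace : ∀ n → AffineSubspace n
  wholeSpace n = record
    { origin = 𝟎 ; dim = n ; basis = standardBasis n
    ; independent = λ as eq → trans (sym (combination-standardBasis as)) eq }

  ∈-wholeSpace : ∀ {n} (x : 𝔽^ n) → x ∈ᵃ wholeSpace n
  ∈-wholeSpace x = x , sym (trans (⊕-identityˡ _) (combination-standardBasis x))

  direction : ∀ {n} (A : AffineSubspace n) → 𝔽^ (dim A) → 𝔽^ n
  direction A as = combination as (basis A)

  -- A point o + b · pivot + (kernel part) has φ-value φ o + b φ(pivot), so the equation φ x = c
  -- forces b = (c - φ o) / φ(pivot). The section is thus a translate of the span of the kernel.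
  hyperplaneSection : ∀ {n k} {φ : 𝔽^ n → Carrier} → IsLinear φ →
    (A : AffineSubspace n) → dim A ≡ suc k → ∀ as → φ (direction A as) ≢ 0# → ∀ c →
    ∃[ B ] dim B ≡ k × (∀ {x} → x ∈ᵃ A → φ x ≡ c → x ∈ᵃ B)
  hyperplaneSection {φ = φ} lin
    record { origin = o ; dim = .(suc _) ; basis = vs ; independent = li } refl as nonzero c =
    record { origin = o ⊕ t • pivot ; dim = _ ; basis = kernel ; independent = kernel-independent }
    , refl , λ { (bs , refl) φx≡c →
      let b , cs , eq = decompose bs in
      cs , (begin
        o ⊕ combination bs vs                 ≡⟨ cong (o ⊕_) eq ⟩
        o ⊕ (b • pivot ⊕ combination cs kernel)
          ≡⟨ ⊕-assoc o (b • pivot) (combination cs kernel) ⟨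
        o ⊕ b • pivot ⊕ combination cs kernel
          ≡⟨ cong (λ s → o ⊕ s • pivot ⊕ combination cs kernel)
                  (coefficient b cs (trans (cong (λ w → φ (o ⊕ w)) (sym eq)) φx≡c)) ⟩
        o ⊕ t • pivot ⊕ combination cs kernel ∎) }
    where
    open IsLinear lin
    open Elimination (eliminate lin vs li as nonzero)
    open ≡-Reasoning
    z = proj₁ (inverse pivot≢0)
    t = (c - φ o) * z
    coefficient : ∀ b cs → φ (o ⊕ (b • pivot ⊕ combination cs kernel)) ≡ c → b ≡ t
    coefficient b cs refl = begin
      b                                              ≡⟨ *-identityʳ b ⟨
      b * 1#                                         ≡⟨ cong (b *_) (proj₂ (inverse pivot≢0)) ⟨
      b * (φ pivot * z)
        ≡⟨ solve 4 (λ b p z o → b :* (p :* z) := (o :+ (b :* p :+ con (ℤ.+ 0)) :- o) :* z) refl b (φ pivot) z (φ o) ⟩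
      (φ o + (b * φ pivot + 0#) - φ o) * z
        ≡⟨ cong (λ e → (φ o + (b * φ pivot + e) - φ o) * z) (kernel-vanishes cs) ⟨
      (φ o + (b * φ pivot + φ (combination cs kernel)) - φ o) * z
        ≡⟨ cong (λ e → (φ o + e - φ o) * z) (combination-∷ b cs pivot kernel) ⟨
      (φ o + φ (b • pivot ⊕ combination cs kernel) - φ o) * z
        ≡⟨ cong (λ e → (e - φ o) * z) (+-homo o _) ⟨
      (φ (o ⊕ (b • pivot ⊕ combination cs kernel)) - φ o) * z ∎

  -- The space is cut first by φ and then by ψ. The second cut could fail only if ψ were constant on
  -- the hyperplane H; then ψ would vanish on ker φ and equal (ψ v / φ v) φ, against independence.
  codimensionTwo : ∀ {k} {φ ψ : 𝔽^ (2 ℕ.+ k) → Carrier} → IsLinear φ → IsLinear ψ →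
    (∀ a b → (∀ x → a * φ x + b * ψ x ≡ 0#) → a ≡ 0# × b ≡ 0#) →
    ∀ x₀ → ∃[ V ] dim V ≡ k × (∀ x → φ x ≡ φ x₀ → ψ x ≡ ψ x₀ → x ∈ᵃ V)
  codimensionTwo {k} {φ} {ψ} φ-linear ψ-linear independent x₀
    with anyVec? (λ x → ¬? (φ x ≟ 0#))
  ... | no φ≡0 = contradiction (proj₁ (independent 1# 0# λ x →
    trans (cong (λ e → 1# * e + 0# * ψ x) (decidable-stable (_ ≟ 0#) λ ≢0 → φ≡0 (x , ≢0)))
          (solve 1 (λ y → con (ℤ.+ 1) :* con (ℤ.+ 0) :+ con (ℤ.+ 0) :* y := con (ℤ.+ 0)) refl (ψ x)))) 1≢0
  ... | yes (v , φv≢0)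
    with H , dimH , ⊆H ← hyperplaneSection φ-linear (wholeSpace (2 ℕ.+ k)) refl v
           (λ eq → φv≢0 (trans (cong φ (sym (combination-standardBasis v))) eq)) (φ x₀)
    with anyVec? (λ as → ¬? (ψ (direction H as) ≟ 0#))
  ...   | yes (as , ψ≢0) with V , dimV , ⊆V ← hyperplaneSection ψ-linear H dimH as ψ≢0 (ψ x₀) =
    V , dimV , λ x φx ψx → ⊆V (⊆H (∈-wholeSpace x) φx) ψx
  ...   | no  ψ≡0 = contradiction (proj₂ (independent (ψ v * z) (- 1#) dependent)) -1≢0
    where
    module φ = IsLinear φ-linear
    module ψ = IsLinear ψ-linear
    z = proj₁ (inverse φv≢0)
    φv*z≡1 = proj₂ (inverse φv≢0)
    open ≡-Reasoning

    -1≢0 : - 1# ≢ 0#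
    -1≢0 eq = 1≢0 (trans (solve 0 (con (ℤ.+ 1) := :- (:- con (ℤ.+ 1))) refl) (trans (cong -_ eq) -0#≈0#))

    ψ-constant : ∀ {x} → x ∈ᵃ H → ψ x ≡ ψ (origin H)
    ψ-constant (as , refl) = begin
      ψ (origin H ⊕ direction H as)        ≡⟨ ψ.+-homo _ _ ⟩
      ψ (origin H) + ψ (direction H as)
        ≡⟨ cong (ψ (origin H) +_) (decidable-stable (_ ≟ 0#) λ ≢0 → ψ≡0 (as , ≢0)) ⟩
      ψ (origin H) + 0#                    ≡⟨ +-identityʳ _ ⟩
      ψ (origin H)                         ∎

    -- Both x₀ and x₀ + w lie in H, where ψ is constant.
    ker⊆ker : ∀ w → φ w ≡ 0# → ψ w ≡ 0#
    ker⊆ker w φw≡0 = begin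
      ψ w                      ≡⟨ solve 2 (λ x w → w := (x :+ w) :- x) refl (ψ x₀) (ψ w) ⟩
      (ψ x₀ + ψ w) - ψ x₀      ≡⟨ cong₂ _-_ (trans (sym (ψ.+-homo x₀ w))
                                    (ψ-constant (⊆H (∈-wholeSpace _) (trans (φ.+-homo x₀ w)
                                      (trans (cong (φ x₀ +_) φw≡0) (+-identityʳ _))))))
                                    (ψ-constant (⊆H (∈-wholeSpace x₀) refl)) ⟩
      ψ (origin H) - ψ (origin H)  ≡⟨ -‿inverseʳ _ ⟩
      0#                       ∎

    dependent : ∀ x → ψ v * z * φ x + - 1# * ψ x ≡ 0#
    dependent x = begin
      ψ v * z * φ x + - 1# * ψ x
        ≡⟨ solve 4 (λ p z f s → p :* z :* f :+ (:- con (ℤ.+ 1)) :* s := :- (s :- f :* z :* p)) refl (ψ v) z (φ x) (ψ x) ⟩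
      - (ψ x - φ x * z * ψ v)
        ≡⟨ cong -_ (ψ.⊖-homo x (φ x * z) v) ⟨
      - ψ (x ⊖ (φ x * z) • v)
        ≡⟨ cong -_ (ker⊆ker _ (begin
             φ (x ⊖ (φ x * z) • v)   ≡⟨ φ.⊖-homo x (φ x * z) v ⟩
             φ x - φ x * z * φ v
               ≡⟨ solve 3 (λ x z v → x :- x :* z :* v := x :* (con (ℤ.+ 1) :- v :* z)) refl (φ x) z (φ v) ⟩
             φ x * (1# - φ v * z)    ≡⟨ cong (λ e → φ x * (1# - e)) φv*z≡1 ⟩
             φ x * (1# - 1#)         ≡⟨ cong (φ x *_) (-‿inverseʳ 1#) ⟩
             φ x * 0#                ≡⟨ zeroʳ (φ x) ⟩
             0#                      ∎)) ⟩
      - 0#                           ≡⟨ -0#≈0# ⟩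
      0#                             ∎

  -- A relation with nonzero coefficient at the new direction y - o could be solved for y - o, which
  -- would put y into `A`.
  extend : ∀ {n} (A : AffineSubspace n) y → ¬ (y ∈ᵃ A) → AffineSubspace n
  extend record { origin = o ; dim = k ; basis = vs ; independent = li } y y∉A = record
    { origin = o ; dim = suc k ; basis = (y ⊖ o) ∷ vs ; independent = independent′ }
    where
    open ≡-Reasoning
    independent′ : LinearlyIndependent ((y ⊖ o) ∷ vs)
    independent′ (a ∷ as) eq with a ≟ 0#
    ... | yes refl = cong (0# ∷_) (li as (begin
      combination as vs                   ≡⟨ ⊕-identityˡ _ ⟨
      𝟎 ⊕ combination as vs               ≡⟨ cong (_⊕ combination as vs) (•-zeroˡ (y ⊖ o)) ⟨
      0# • (y ⊖ o) ⊕ combination as vs    ≡⟨ eq ⟩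
      𝟎                                   ∎))
    ... | no a≢0 with z , a*z≡1 ← inverse a≢0 = contradiction ((- z) • as , (begin
      y                                     ≡⟨ ⊕-⊖-cancel o y ⟨
      o ⊕ (y ⊖ o)                           ≡⟨ cong (o ⊕_) (solve-for a*z≡1 _ _ eq) ⟩
      o ⊕ (- z) • combination as vs         ≡⟨ cong (o ⊕_) (combination-• (- z) as vs) ⟨
      o ⊕ combination ((- z) • as) vs       ∎)) y∉A
      where
      solve-for : a * z ≡ 1# → ∀ {n} (v w : 𝔽^ n) → a • v ⊕ w ≡ 𝟎 → v ≡ (- z) • w
      solve-for a*z≡1 []      []      _  = refl
      solve-for a*z≡1 (v ∷ vs) (w ∷ ws) eq = cong₂ _∷_ (begin
        v                              ≡⟨ *-identityˡ v ⟨
        1# * v                         ≡⟨ cong (_* v) a*z≡1 ⟨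
        a * z * v
          ≡⟨ solve 4 (λ a z v w → a :* z :* v := z :* (a :* v :+ w) :+ (:- z) :* w) refl a z v w ⟩
        z * (a * v + w) + - z * w      ≡⟨ cong (λ e → z * e + - z * w) (∷-injectiveˡ eq) ⟩
        z * 0# + - z * w               ≡⟨ solve 2 (λ z w → z :* con (ℤ.+ 0) :+ (:- z) :* w := (:- z) :* w) refl z w ⟩
        - z * w                        ∎) (solve-for a*z≡1 vs ws (∷-injectiveʳ eq))

  singleton : ∀ {n} → 𝔽^ n → AffineSubspace n
  singleton y = record { origin = y ; dim = 0 ; basis = [] ; independent = λ { [] _ → refl } }

  init-⊕ : ∀ {n} (x y : 𝔽^ (suc n)) → init (x ⊕ y) ≡ init x ⊕ init y
  init-⊕ {zero}  (x ∷ [])       (y ∷ [])       = refl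
  init-⊕ {suc n} (x ∷ u@(_ ∷ _)) (y ∷ v@(_ ∷ _)) = cong ((x + y) ∷_) (init-⊕ u v)

  init-• : ∀ {n} a (x : 𝔽^ (suc n)) → init (a • x) ≡ a • init x
  init-• {zero}  a (x ∷ [])       = refl
  init-• {suc n} a (x ∷ u@(_ ∷ _)) = cong ((a * x) ∷_) (init-• a u)

  last-⊕ : ∀ {n} (x y : 𝔽^ (suc n)) → last (x ⊕ y) ≡ last x + last y
  last-⊕ {zero}  (x ∷ [])       (y ∷ [])       = refl
  last-⊕ {suc n} (x ∷ u@(_ ∷ _)) (y ∷ v@(_ ∷ _)) = last-⊕ u v

  last-• : ∀ {n} a (x : 𝔽^ (suc n)) → last (a • x) ≡ a * last x
  last-• {zero}  a (x ∷ [])       = refl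
  last-• {suc n} a (x ∷ u@(_ ∷ _)) = last-• a u

  init-∷ʳ-last : ∀ {n} (x : 𝔽^ (suc n)) → init x ∷ʳ last x ≡ x
  init-∷ʳ-last x = sym (proj₂ (proj₂ (Vec.initLast x)))

  𝟎-∷ʳ : ∀ {n} → 𝟎 {n} ∷ʳ 0# ≡ 𝟎
  𝟎-∷ʳ {zero}  = refl
  𝟎-∷ʳ {suc n} = cong (0# ∷_) 𝟎-∷ʳ

  combination-init : ∀ {n k} (as : 𝔽^ k) (vs : Vec (𝔽^ (suc n)) k) →
                     combination as (Vec.map init vs) ≡ init (combination as vs)
  combination-init []       []       = sym (trans (cong init (sym (•-zeroˡ 𝟎))) (trans (init-• 0# 𝟎) (•-zeroˡ _)))
  combination-init (a ∷ as) (v ∷ vs) = begin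
    a • init v ⊕ combination as (Vec.map init vs)  ≡⟨ cong₂ _⊕_ (sym (init-• a v)) (combination-init as vs) ⟩
    init (a • v) ⊕ init (combination as vs)        ≡⟨ init-⊕ (a • v) _ ⟨
    init (a • v ⊕ combination as vs)               ∎
    where open ≡-Reasoning

-- Lifted spheres

module SphereGeometry {q k : ℕ} (F : FiniteField q)
  (Q : VectorSpace.QuadraticForm F (2 ℕ.+ k)) (nondegenerate : VectorSpace.QuadraticForm.Nondegenerate Q)
  where
  open FiniteField F
  open FieldArithmetic F
  open VectorSpace F
  open LinearAlgebra F
  open QuadraticForm Q
  open Spheres F Q
  private
    d = 2 ℕ.+ k
    module Linear = IsLinear

  -- If 2 = 0 then the total division makes ⟨_,_⟩ vanish identically.
  2≢0 : 2# ≢ 0#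
  2≢0 2≡0 = 1≢0 (∷-injectiveˡ (nondegenerate (1# ∷ 𝟎) λ y → /0 (polar ⟦_⟧ (1# ∷ 𝟎) y)))
    where
    /0 : ∀ x → x / 2# ≡ 0#
    /0 x with 2# ≟ 0#
    ... | yes _  = refl
    ... | no 2≢0 = contradiction 2≡0 2≢0

  ½ : Carrier
  ½ = proj₁ (/-inverse 2≢0)

  2*½≡1 : 2# * ½ ≡ 1#
  2*½≡1 = proj₁ (proj₂ (/-inverse 2≢0))

  form-def : ∀ x y → ⟨ x , y ⟩ ≡ polar ⟦_⟧ x y * ½
  form-def x y = proj₂ (proj₂ (/-inverse 2≢0)) (polar ⟦_⟧ x y)

  polar-comm : ∀ x y → polar ⟦_⟧ x y ≡ polar ⟦_⟧ y x
  polar-comm x y = trans (cong (λ w → ⟦ w ⟧ - ⟦ x ⟧ - ⟦ y ⟧) (⊕-comm x y))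
    (solve 3 (λ a b c → a :- b :- c := a :- c :- b) refl ⟦ y ⊕ x ⟧ ⟦ x ⟧ ⟦ y ⟧)

  form-comm : ∀ x y → ⟨ x , y ⟩ ≡ ⟨ y , x ⟩
  form-comm x y = trans (form-def x y) (trans (cong (_* ½) (polar-comm x y)) (sym (form-def y x)))

  form-linearˡ : ∀ u → IsLinear (λ x → ⟨ x , u ⟩)
  form-linearˡ u = record
    { +-homo = λ x y → begin
        ⟨ x ⊕ y , u ⟩                          ≡⟨ form-def (x ⊕ y) u ⟩
        polar ⟦_⟧ (x ⊕ y) u * ½                ≡⟨ cong (_* ½) (polar-+ x y u) ⟩
        (polar ⟦_⟧ x u + polar ⟦_⟧ y u) * ½
          ≡⟨ solve 3 (λ a b c → (a :+ b) :* c := a :* c :+ b :* c) refl (polar ⟦_⟧ x u) (polar ⟦_⟧ y u) ½ ⟩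
        polar ⟦_⟧ x u * ½ + polar ⟦_⟧ y u * ½  ≡⟨ cong₂ _+_ (form-def x u) (form-def y u) ⟨
        ⟨ x , u ⟩ + ⟨ y , u ⟩                  ∎
    ; *-homo = λ a x → begin
        ⟨ a • x , u ⟩              ≡⟨ form-def (a • x) u ⟩
        polar ⟦_⟧ (a • x) u * ½    ≡⟨ cong (_* ½) (polar-* a x u) ⟩
        a * polar ⟦_⟧ x u * ½      ≡⟨ *-assoc a (polar ⟦_⟧ x u) ½ ⟩
        a * (polar ⟦_⟧ x u * ½)    ≡⟨ cong (a *_) (form-def x u) ⟨
        a * ⟨ x , u ⟩              ∎
    }
    where open ≡-Reasoning

  form-linearʳ : ∀ x → IsLinear (λ u → ⟨ x , u ⟩)
  form-linearʳ x = record
    { +-homo = λ u v → trans (form-comm x (u ⊕ v))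
        (trans (Linear.+-homo (form-linearˡ x) u v) (cong₂ _+_ (form-comm u x) (form-comm v x)))
    ; *-homo = λ a u → trans (form-comm x (a • u))
        (trans (Linear.*-homo (form-linearˡ x) a u) (cong (a *_) (form-comm u x)))
    }

  ⟦x⊖c⟧ : ∀ x c → ⟦ x ⊖ c ⟧ ≡ ⟦ x ⟧ + ⟦ c ⟧ - polar ⟦_⟧ x c
  ⟦x⊖c⟧ x c = begin
    ⟦ x ⊖ c ⟧                ≡⟨ cong ⟦_⟧ (⊖-as-⊕ x c) ⟩
    ⟦ x ⊕ (- 1#) • c ⟧
      ≡⟨ solve 3 (λ s a b → s := (s :- a :- b) :+ a :+ b) refl _ ⟦ x ⟧ ⟦ (- 1#) • c ⟧ ⟩
    polar ⟦_⟧ x ((- 1#) • c) + ⟦ x ⟧ + ⟦ (- 1#) • c ⟧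
      ≡⟨ cong₂ (λ a b → a + ⟦ x ⟧ + b)
           (trans (polar-comm x _) (trans (polar-* (- 1#) c x) (cong (- 1# *_) (polar-comm c x))))
           (homogeneous (- 1#) c) ⟩
    - 1# * polar ⟦_⟧ x c + ⟦ x ⟧ + - 1# * - 1# * ⟦ c ⟧
      ≡⟨ solve 3 (λ p a b → (:- con (ℤ.+ 1)) :* p :+ a :+ (:- con (ℤ.+ 1)) :* (:- con (ℤ.+ 1)) :* b := a :+ b :- p)
           refl (polar ⟦_⟧ x c) ⟦ x ⟧ ⟦ c ⟧ ⟩
    ⟦ x ⟧ + ⟦ c ⟧ - polar ⟦_⟧ x c ∎
    where open ≡-Reasoning

  -- The factor 2 in the lifted centre cancels the half in ⟨x, c⟩, and the term -(r - Q(c))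
  -- completes Q(x) - 2⟨x, c⟩ to Q(x - c) - r.
  Λ-Φ : ∀ x c r → Λ x (Φ (c , r)) ≡ ⟦ x ⊖ c ⟧ - r
  Λ-Φ x c r = begin
    ⟦ x ⟧ - ⟨ x , init (Φ (c , r)) ⟩ - last (Φ (c , r))
      ≡⟨ cong₂ (λ u a → ⟦ x ⟧ - ⟨ x , u ⟩ - a) (init-∷ʳ _ (2# • c)) (last-∷ʳ _ (2# • c)) ⟩
    ⟦ x ⟧ - ⟨ x , 2# • c ⟩ - (r - ⟦ c ⟧)
      ≡⟨ cong (λ e → ⟦ x ⟧ - e - (r - ⟦ c ⟧)) (begin
           ⟨ x , 2# • c ⟩             ≡⟨ Linear.*-homo (form-linearʳ x) 2# c ⟩
           2# * ⟨ x , c ⟩             ≡⟨ cong (2# *_) (form-def x c) ⟩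
           2# * (polar ⟦_⟧ x c * ½)   ≡⟨ solve 3 (λ t p h → t :* (p :* h) := t :* h :* p) refl 2# (polar ⟦_⟧ x c) ½ ⟩
           2# * ½ * polar ⟦_⟧ x c     ≡⟨ cong (_* polar ⟦_⟧ x c) 2*½≡1 ⟩
           1# * polar ⟦_⟧ x c         ≡⟨ *-identityˡ _ ⟩
           polar ⟦_⟧ x c              ∎) ⟩
    ⟦ x ⟧ - polar ⟦_⟧ x c - (r - ⟦ c ⟧)
      ≡⟨ solve 4 (λ a p r b → a :- p :- (r :- b) := (a :+ b :- p) :- r) refl ⟦ x ⟧ (polar ⟦_⟧ x c) r ⟦ c ⟧ ⟩
    (⟦ x ⟧ + ⟦ c ⟧ - polar ⟦_⟧ x c) - r
      ≡⟨ cong (_- r) (⟦x⊖c⟧ x c) ⟨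
    ⟦ x ⊖ c ⟧ - r ∎
    where open ≡-Reasoning

  ∈ˢ⇒Λ≡0 : ∀ x S → x ∈ˢ S → Λ x (Φ S) ≡ 0#
  ∈ˢ⇒Λ≡0 x (c , r) refl = trans (Λ-Φ x c r) (-‿inverseʳ _)

  Λ≡0⇒∈ˢ : ∀ x S → Λ x (Φ S) ≡ 0# → x ∈ˢ S
  Λ≡0⇒∈ˢ x (c , r) eq = begin
    ⟦ x ⊖ c ⟧          ≡⟨ solve 2 (λ a r → a := (a :- r) :+ r) refl ⟦ x ⊖ c ⟧ r ⟩
    ⟦ x ⊖ c ⟧ - r + r  ≡⟨ cong (_+ r) (trans (sym (Λ-Φ x c r)) eq) ⟩
    0# + r             ≡⟨ +-identityˡ r ⟩
    r                  ∎
    where open ≡-Reasoning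

  -- The inverse of Φ, found by solving 2c = u and r - Q(c) = a. Every point of the lifted space is
  -- therefore the lift of exactly one sphere.
  Ψ : 𝔽^ (suc d) → Sphere
  Ψ y = ½ • init y , last y + ⟦ ½ • init y ⟧

  ½2 : ∀ {n} (x : 𝔽^ n) → ½ • 2# • x ≡ x
  ½2 x = trans (sym (•-assoc ½ 2# x))
    (trans (cong (_• x) (trans (*-comm ½ 2#) 2*½≡1)) (•-identityˡ x))

  2½ : ∀ {n} (x : 𝔽^ n) → 2# • ½ • x ≡ x
  2½ x = trans (sym (•-assoc 2# ½ x)) (trans (cong (_• x) 2*½≡1) (•-identityˡ x))

  Φ-Ψ : ∀ y → Φ (Ψ y) ≡ y
  Φ-Ψ y = trans (cong₂ _∷ʳ_ (2½ (init y))
    (solve 2 (λ a b → a :+ b :- b := a) refl (last y) ⟦ ½ • init y ⟧)) (init-∷ʳ-last y)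

  Ψ-Φ : ∀ S → Ψ (Φ S) ≡ S
  Ψ-Φ (c , r) = cong₂ _,_ ½init (trans
    (cong₂ (λ a w → a + ⟦ w ⟧) (last-∷ʳ (r - ⟦ c ⟧) (2# • c)) ½init)
    (solve 2 (λ a b → a :- b :+ b := a) refl r ⟦ c ⟧))
    where
    ½init : ½ • init (Φ (c , r)) ≡ c
    ½init = trans (cong (½ •_) (init-∷ʳ _ (2# • c))) (½2 c)

  Φ-injective : ∀ {S S′} → Φ S ≡ Φ S′ → S ≡ S′
  Φ-injective {S} {S′} eq = trans (sym (Ψ-Φ S)) (trans (cong Ψ eq) (Ψ-Φ S′))

  -- The linear part of Λ x, with the opposite sign.
  slope : Point → 𝔽^ (suc d) → Carrier
  slope x v = ⟨ x , init v ⟩ + last v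

  slope-linear : ∀ x → IsLinear (slope x)
  slope-linear x = record
    { +-homo = λ v w → begin
        ⟨ x , init (v ⊕ w) ⟩ + last (v ⊕ w)
          ≡⟨ cong₂ _+_ (trans (cong ⟨ x ,_⟩ (init-⊕ v w)) (Linear.+-homo (form-linearʳ x) _ _)) (last-⊕ v w) ⟩
        (⟨ x , init v ⟩ + ⟨ x , init w ⟩) + (last v + last w)
          ≡⟨ solve 4 (λ a b c e → (a :+ b) :+ (c :+ e) := (a :+ c) :+ (b :+ e)) refl
               ⟨ x , init v ⟩ ⟨ x , init w ⟩ (last v) (last w) ⟩
        slope x v + slope x w ∎
    ; *-homo = λ a v → begin
        ⟨ x , init (a • v) ⟩ + last (a • v)
          ≡⟨ cong₂ _+_ (trans (cong ⟨ x ,_⟩ (init-• a v)) (Linear.*-homo (form-linearʳ x) a _)) (last-• a v) ⟩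
        a * ⟨ x , init v ⟩ + a * last v
          ≡⟨ solve 3 (λ a b c → a :* b :+ a :* c := a :* (b :+ c)) refl a ⟨ x , init v ⟩ (last v) ⟩
        a * slope x v ∎
    }
    where open ≡-Reasoning

  Λ-⊕ : ∀ x y v → Λ x (y ⊕ v) ≡ Λ x y - slope x v
  Λ-⊕ x y v = trans
    (cong₂ (λ a b → ⟦ x ⟧ - a - b)
      (trans (cong ⟨ x ,_⟩ (init-⊕ y v)) (Linear.+-homo (form-linearʳ x) _ _)) (last-⊕ y v))
    (solve 5 (λ s a b c e → s :- (a :+ b) :- (c :+ e) := s :- a :- c :- (b :+ e)) refl
      ⟦ x ⟧ ⟨ x , init y ⟩ ⟨ x , init v ⟩ (last y) (last v))

  slope≡0 : ∀ x y v → Λ x y ≡ 0# → Λ x (y ⊕ v) ≡ 0# → slope x v ≡ 0#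
  slope≡0 x y v Λy≡0 Λy⊕v≡0 = begin
    slope x v                       ≡⟨ solve 2 (λ a b → b := a :- (a :- b)) refl (Λ x y) (slope x v) ⟩
    Λ x y - (Λ x y - slope x v)     ≡⟨ cong₂ _-_ Λy≡0 (trans (sym (Λ-⊕ x y v)) Λy⊕v≡0) ⟩
    0# - 0#                         ≡⟨ -‿inverseʳ 0# ⟩
    0#                              ∎
    where open ≡-Reasoning

  slope≡0⇒Λ : ∀ x y v → slope x v ≡ 0# → Λ x (y ⊕ v) ≡ Λ x y
  slope≡0⇒Λ x y v eq = trans (Λ-⊕ x y v)
    (trans (cong (λ e → Λ x y - e) eq) (solve 1 (λ a → a :- con (ℤ.+ 0) := a) refl (Λ x y)))

  -- Vanishing slope reads last v = -⟨x, init v⟩, so `init` is injective on the kernel of `slope x`.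
  -- Both dimension arguments rest on this.
  slope∧init≡0⇒≡𝟎 : ∀ x v → slope x v ≡ 0# → init v ≡ 𝟎 → v ≡ 𝟎
  slope∧init≡0⇒≡𝟎 x v slope≡0 init≡𝟎 =
    trans (sym (init-∷ʳ-last v)) (trans (cong₂ _∷ʳ_ init≡𝟎 last≡0) 𝟎-∷ʳ)
    where
    open ≡-Reasoning
    last≡0 : last v ≡ 0#
    last≡0 = begin
      last v                     ≡⟨ +-identityˡ _ ⟨
      0# + last v                ≡⟨ cong (_+ last v) (Linear.0-homo (form-linearʳ x)) ⟨
      ⟨ x , 𝟎 ⟩ + last v         ≡⟨ cong (λ u → ⟨ x , u ⟩ + last v) init≡𝟎 ⟨
      slope x v                  ≡⟨ slope≡0 ⟩
      0#                         ∎

  -- The set B(L) and the dimension of L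

  origin∈ : ∀ {n} (L : AffineSubspace n) → origin L ∈ᵃ L
  origin∈ L = 𝟎 , sym (trans (cong (origin L ⊕_) (combination-𝟎 (basis L))) (⊕-identityʳ _))

  B⇒slope≡0 : ∀ L {x} → B⟨ L ⟩ x → ∀ as → slope x (direction L as) ≡ 0#
  B⇒slope≡0 L {x} x∈B as = slope≡0 x (origin L) (direction L as) (x∈B _ (origin∈ L)) (x∈B _ (as , refl))

  B-intro : ∀ L {x} → Λ x (origin L) ≡ 0# → (∀ as → slope x (direction L as) ≡ 0#) → B⟨ L ⟩ x
  B-intro L {x} Λ≡0 slope≡0 _ (as , refl) = trans (slope≡0⇒Λ x (origin L) (direction L as) (slope≡0 as)) Λ≡0

  B-singleton : ∀ {x} y → Λ x y ≡ 0# → B⟨ singleton y ⟩ x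
  B-singleton {x} y Λ≡0 = B-intro (singleton y) Λ≡0 λ { [] → Linear.0-homo (slope-linear x) }

  -- Λ x vanishes at the origin of L and at y, so its linear part kills the difference, which is the
  -- one new direction.
  B-extend : ∀ L {x} y y∉L → B⟨ L ⟩ x → Λ x y ≡ 0# → B⟨ extend L y y∉L ⟩ x
  B-extend L {x} y y∉L x∈B Λy≡0 = B-intro (extend L y y∉L) Λo≡0 λ { (a ∷ as) → begin
    slope x (a • (y ⊖ origin L) ⊕ direction L as)
      ≡⟨ Linear.combination-∷ (slope-linear x) a as (y ⊖ origin L) (basis L) ⟩
    a * slope x (y ⊖ origin L) + slope x (direction L as)
      ≡⟨ cong₂ (λ s t → a * s + t)
           (slope≡0 x (origin L) (y ⊖ origin L) Λo≡0 (trans (cong (Λ x) (⊕-⊖-cancel (origin L) y)) Λy≡0)) (B⇒slope≡0 L x∈B as) ⟩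
    a * 0# + 0#
      ≡⟨ trans (+-identityʳ _) (zeroʳ a) ⟩
    0# ∎ }
    where
    open ≡-Reasoning
    Λo≡0 = x∈B _ (origin∈ L)

  -- The directions of L lie in the kernel of `slope x`, where `init` is injective; the projected
  -- basis is thus an independent family in a space of dimension d.
  dim≤d : ∀ L {x} → B⟨ L ⟩ x → dim L ≤ d
  dim≤d L {x} x∈B = independent⇒≤ (Vec.map init (basis L)) λ as eq →
    independent L as (slope∧init≡0⇒≡𝟎 x _ (B⇒slope≡0 L x∈B as) (trans (sym (combination-init as (basis L))) eq))

  -- For the first two basis vectors v and w, vanishing slope says ⟨x, init v⟩ = -last v and ⟨x,
  -- init w⟩ = -last w. The right sides do not depend on x, so on B(L) both functionals keep their
  -- values at x₀.
  B⊆codimensionTwo : ∀ L {x₀} → 2 ≤ dim L → B⟨ L ⟩ x₀ →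
                     ∃[ V ] dim V ≡ k × (∀ {x} → B⟨ L ⟩ x → x ∈ᵃ V)
  B⊆codimensionTwo L@record { dim = suc (suc l) ; basis = v ∷ w ∷ vs ; independent = li } {x₀} (s≤s (s≤s z≤n)) x₀∈B
    = let V , dimV , ⊆V = codimensionTwo (form-linearˡ (init v)) (form-linearˡ (init w)) nonproportional x₀ in
    V , dimV , λ {x} x∈B → ⊆V x (agree v v-slope x∈B) (agree w w-slope x∈B)
    where
    open ≡-Reasoning
    v-slope : ∀ {x} → B⟨ L ⟩ x → slope x v ≡ 0#
    v-slope {x} x∈B = trans (cong (slope x) (sym v-direction)) (B⇒slope≡0 L x∈B (1# ∷ 0# ∷ 𝟎))
      where
      v-direction : direction L (1# ∷ 0# ∷ 𝟎) ≡ v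
      v-direction = trans (cong₂ _⊕_ (•-identityˡ v) (trans (cong₂ _⊕_ (•-zeroˡ w) (combination-𝟎 vs)) (⊕-identityˡ 𝟎))) (⊕-identityʳ v)
    w-slope : ∀ {x} → B⟨ L ⟩ x → slope x w ≡ 0#
    w-slope {x} x∈B = trans (cong (slope x) (sym w-direction)) (B⇒slope≡0 L x∈B (0# ∷ 1# ∷ 𝟎))
      where
      w-direction : direction L (0# ∷ 1# ∷ 𝟎) ≡ w
      w-direction = trans (cong₂ _⊕_ (•-zeroˡ v) (trans (cong₂ _⊕_ (•-identityˡ w) (combination-𝟎 vs)) (⊕-identityʳ w))) (⊕-identityˡ w)

    agree : ∀ u → (∀ {x} → B⟨ L ⟩ x → slope x u ≡ 0#) → ∀ {x} → B⟨ L ⟩ x →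
            ⟨ x , init u ⟩ ≡ ⟨ x₀ , init u ⟩
    agree u u-slope x∈B = trans (⟨⟩≡-last x∈B) (sym (⟨⟩≡-last x₀∈B))
      where
      ⟨⟩≡-last : ∀ {x} → B⟨ L ⟩ x → ⟨ x , init u ⟩ ≡ - last u
      ⟨⟩≡-last {x} x∈B = begin
        ⟨ x , init u ⟩         ≡⟨ solve 2 (λ a b → a := (a :+ b) :- b) refl ⟨ x , init u ⟩ (last u) ⟩
        slope x u - last u     ≡⟨ cong (_- last u) (u-slope x∈B) ⟩
        0# - last u            ≡⟨ +-identityˡ _ ⟩
        - last u               ∎

    nonproportional : ∀ a b → (∀ x → a * ⟨ x , init v ⟩ + b * ⟨ x , init w ⟩ ≡ 0#) → a ≡ 0# × b ≡ 0#
    nonproportional a b vanishes = ∷-injectiveˡ coefficients≡𝟎 , ∷-injectiveˡ (∷-injectiveʳ coefficients≡𝟎)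
      where
      -- Keeping the zero tail makes `u` literally the combination with coefficients `a ∷ b ∷ 𝟎`, to
      -- which `li` applies.
      u = a • v ⊕ (b • w ⊕ combination 𝟎 vs)
      init-u : init u ≡ a • init v ⊕ b • init w
      init-u = begin
        init u                             ≡⟨ cong (λ z → init (a • v ⊕ z)) (trans (cong (b • w ⊕_) (combination-𝟎 vs)) (⊕-identityʳ _)) ⟩
        init (a • v ⊕ b • w)               ≡⟨ init-⊕ (a • v) (b • w) ⟩
        init (a • v) ⊕ init (b • w)        ≡⟨ cong₂ _⊕_ (init-• a v) (init-• b w) ⟩
        a • init v ⊕ b • init w            ∎
      init-u≡𝟎 : init u ≡ 𝟎
      -- A relation between the functionals makes `init u` orthogonal to every y. Once `init u` is
      -- zero, the vanishing slope at x₀ makes u itself zero.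
      init-u≡𝟎 = nondegenerate (init u) λ y → begin
        ⟨ init u , y ⟩                                 ≡⟨ form-comm _ y ⟩
        ⟨ y , init u ⟩                                 ≡⟨ cong ⟨ y ,_⟩ init-u ⟩
        ⟨ y , a • init v ⊕ b • init w ⟩                ≡⟨ Linear.+-homo (form-linearʳ y) _ _ ⟩
        ⟨ y , a • init v ⟩ + ⟨ y , b • init w ⟩
          ≡⟨ cong₂ _+_ (Linear.*-homo (form-linearʳ y) a _) (Linear.*-homo (form-linearʳ y) b _) ⟩
        a * ⟨ y , init v ⟩ + b * ⟨ y , init w ⟩        ≡⟨ vanishes y ⟩
        0#                                             ∎
      coefficients≡𝟎 : a ∷ b ∷ 𝟎 ≡ 𝟎
      coefficients≡𝟎 = li (a ∷ b ∷ 𝟎) (slope∧init≡0⇒≡𝟎 x₀ u (B⇒slope≡0 L x₀∈B (a ∷ b ∷ 𝟎)) init-u≡𝟎)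

  dim≥1 : ∀ L {S S′} → 𝒮⟨ L ⟩ S → 𝒮⟨ L ⟩ S′ → S ≢ S′ → 1 ≤ dim L
  dim≥1 record { dim = zero ; basis = [] } ([] , eq) ([] , eq′) S≢S′ =
    contradiction (Φ-injective (trans eq (sym eq′))) S≢S′
  dim≥1 record { dim = suc _ } _ _ _ = s≤s z≤n

  -- Affine lines and coaxal pencils

  module Line (o v : 𝔽^ (suc d)) (li : LinearlyIndependent (v ∷ [])) where
    L : AffineSubspace (suc d)
    L = record { origin = o ; dim = 1 ; basis = v ∷ [] ; independent = li }

    point : Carrier → 𝔽^ (suc d)
    point t = o ⊕ (t • v ⊕ 𝟎)

    ∈⇒point : ∀ {y} → y ∈ᵃ L → ∃[ t ] y ≡ point t
    ∈⇒point (t ∷ [] , eq) = t , eq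

    point∈ : ∀ t → point t ∈ᵃ L
    point∈ t = t ∷ [] , refl

    Λ-point : ∀ x t → Λ x (point t) ≡ Λ x o - t * slope x v
    Λ-point x t = trans (Λ-⊕ x o _) (cong (λ e → Λ x o - e)
      (trans (cong (slope x) (⊕-identityʳ (t • v))) (Linear.*-homo (slope-linear x) t v)))

    point-injective : ∀ {s t} → point s ≡ point t → s ≡ t
    point-injective {s} {t} eq = begin
      s               ≡⟨ solve 2 (λ s t → s := (s :- t) :+ t) refl s t ⟩
      s - t + t       ≡⟨ cong (_+ t) (∷-injectiveˡ (li (s - t ∷ []) (difference o v eq))) ⟩
      0# + t          ≡⟨ +-identityˡ t ⟩
      t               ∎
      where
      open ≡-Reasoning
      difference : ∀ {n} (o v : 𝔽^ n) → o ⊕ (s • v ⊕ 𝟎) ≡ o ⊕ (t • v ⊕ 𝟎) → (s - t) • v ⊕ 𝟎 ≡ 𝟎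
      difference []      []      _  = refl
      difference (o ∷ os) (v ∷ vs) eq = cong₂ _∷_ (begin
        (s - t) * v + 0#
          ≡⟨ solve 4 (λ o s t v → (s :- t) :* v :+ con (ℤ.+ 0) := (o :+ (s :* v :+ con (ℤ.+ 0))) :- (o :+ (t :* v :+ con (ℤ.+ 0)))) refl o s t v ⟩
        (o + (s * v + 0#)) - (o + (t * v + 0#))   ≡⟨ cong (_- (o + (t * v + 0#))) (∷-injectiveˡ eq) ⟩
        (o + (t * v + 0#)) - (o + (t * v + 0#))   ≡⟨ -‿inverseʳ _ ⟩
        0#                                        ∎) (difference os vs (∷-injectiveʳ eq))

    onLine : ∀ t → point t ≡ point 0# ⊕ t • (point 1# ⊖ point 0#)
    onLine t = go o v
      where
      go : ∀ {n} (o v : 𝔽^ n) → o ⊕ (t • v ⊕ 𝟎) ≡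
           (o ⊕ (0# • v ⊕ 𝟎)) ⊕ t • ((o ⊕ (1# • v ⊕ 𝟎)) ⊖ (o ⊕ (0# • v ⊕ 𝟎)))
      go []      []      = refl
      go (o ∷ os) (v ∷ vs) = cong₂ _∷_
        (solve 3 (λ o t v → let 0′ = con (ℤ.+ 0) in let 1′ = con (ℤ.+ 1) in
          o :+ (t :* v :+ 0′) := (o :+ (0′ :* v :+ 0′)) :+ t :* ((o :+ (1′ :* v :+ 0′)) :- (o :+ (0′ :* v :+ 0′))))
          refl o t v)
        (go os vs)

    -- Since Φ is bijective, the field elements t parametrize the members by the spheres with lift
    -- `point t`; those at t = 0 and t = 1 serve as the generating pair, and the enumeration of the
    -- field lists all q of them.
    isCoaxalPencil : IsCoaxalPencil 𝒮⟨ L ⟩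
    isCoaxalPencil = record
      { S₀            = sphere 0#
      ; S₁            = sphere 1#
      ; distinct      = λ eq → 1≢0 (sym (sphere-injective eq))
      ; lifts-on-line = λ y → mk⇔
          (λ { (S , ΦS∈L , refl) → let t , eq = ∈⇒point ΦS∈L in t , trans eq (onLine′ t) })
          (λ { (t , refl) → sphere t , subst (_∈ᵃ L) (sym (Φ-Ψ _)) (point∈ t) , trans (Φ-Ψ _) (onLine′ t) })
      ; members       = record { elements = map (λ i → sphere (from i)) (allFin q)
                               ; unique   = Unique.map⁺ (λ eq → from-injective (sphere-injective eq)) (Unique.allFin⁺ q) }
      ; q-members     = trans (length-map (λ i → sphere (from i)) (allFin q)) (length-tabulate id)
      ; is-members    = λ S → mk⇔
          (λ ΦS∈L → let t , eq = ∈⇒point ΦS∈L in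
            subst (_∈ _)
              (trans (cong sphere (strictlyInverseʳ t)) (trans (cong Ψ (sym eq)) (Ψ-Φ S)))
              (∈-map⁺ (λ i → sphere (from i)) (∈-allFin (to t))))
          (λ S∈ → let i , _ , eq = ∈-map⁻ (λ i → sphere (from i)) S∈ in
            subst (λ S → Φ S ∈ᵃ L) (sym eq) (subst (_∈ᵃ L) (sym (Φ-Ψ _)) (point∈ (from i))))
      }
      where
      open Inverse enumeration
      sphere : Carrier → Sphere
      sphere t = Ψ (point t)
      sphere-injective : ∀ {s t} → sphere s ≡ sphere t → s ≡ t
      sphere-injective eq = point-injective (trans (sym (Φ-Ψ _)) (trans (cong Φ eq) (Φ-Ψ _)))
      from-injective : ∀ {i j} → from i ≡ from j → i ≡ j
      from-injective eq = trans (sym (strictlyInverseˡ _)) (trans (cong to eq) (strictlyInverseˡ _))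
      onLine′ : ∀ t → point t ≡ Φ (sphere 0#) ⊕ t • (Φ (sphere 1#) ⊖ Φ (sphere 0#))
      onLine′ t = trans (onLine t) (sym (cong₂ (λ a b → a ⊕ t • (b ⊖ a)) (Φ-Ψ (point 0#)) (Φ-Ψ (point 1#))))

    -- Along the line Λ x is the affine function Λ x o - t · slope x v of t. If it vanishes at two
    -- distinct parameters, both its coefficients are zero.
    B⇔section : ∀ S S′ → 𝒮⟨ L ⟩ S → 𝒮⟨ L ⟩ S′ → S ≢ S′ → ∀ x → B⟨ L ⟩ x ⇔ (x ∈ˢ S × x ∈ˢ S′)
    B⇔section S S′ S∈ S′∈ S≢S′ x = mk⇔
      (λ x∈B → Λ≡0⇒∈ˢ x S (x∈B _ S∈) , Λ≡0⇒∈ˢ x S′ (x∈B _ S′∈))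
      λ (x∈S , x∈S′) → section⊆B (∈ˢ⇒Λ≡0 x S x∈S) (∈ˢ⇒Λ≡0 x S′ x∈S′)
      where
      open ≡-Reasoning
      s = proj₁ (∈⇒point S∈)
      t = proj₁ (∈⇒point S′∈)
      s-t≢0 : s - t ≢ 0#
      s-t≢0 eq = S≢S′ (Φ-injective (trans (proj₂ (∈⇒point S∈)) (trans (cong point s≡t) (sym (proj₂ (∈⇒point S′∈))))))
        where
        s≡t : s ≡ t
        s≡t = trans (solve 2 (λ s t → s := (s :- t) :+ t) refl s t) (trans (cong (_+ t) eq) (+-identityˡ t))
      section⊆B : Λ x (Φ S) ≡ 0# → Λ x (Φ S′) ≡ 0# → B⟨ L ⟩ x
      section⊆B ΛS≡0 ΛS′≡0 = B-intro L Λo≡0 λ { (a ∷ []) → begin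
        slope x (a • v ⊕ 𝟎)     ≡⟨ cong (slope x) (⊕-identityʳ (a • v)) ⟩
        slope x (a • v)         ≡⟨ Linear.*-homo (slope-linear x) a v ⟩
        a * slope x v           ≡⟨ cong (a *_) slope≡0′ ⟩
        a * 0#                  ≡⟨ zeroʳ a ⟩
        0#                      ∎ }
        where
        Λs : Λ x o - s * slope x v ≡ 0#
        Λs = trans (sym (Λ-point x s)) (trans (cong (Λ x) (sym (proj₂ (∈⇒point S∈)))) ΛS≡0)
        Λt : Λ x o - t * slope x v ≡ 0#
        Λt = trans (sym (Λ-point x t)) (trans (cong (Λ x) (sym (proj₂ (∈⇒point S′∈)))) ΛS′≡0)
        z = proj₁ (inverse s-t≢0)
        slope≡0′ : slope x v ≡ 0#
        slope≡0′ = begin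
          slope x v                  ≡⟨ *-identityˡ _ ⟨
          1# * slope x v             ≡⟨ cong (_* slope x v) (proj₂ (inverse s-t≢0)) ⟨
          (s - t) * z * slope x v
            ≡⟨ solve 5 (λ s t z e o → (s :- t) :* z :* e := z :* ((o :- t :* e) :- (o :- s :* e))) refl s t z (slope x v) (Λ x o) ⟩
          z * ((Λ x o - t * slope x v) - (Λ x o - s * slope x v))
            ≡⟨ cong₂ (λ a b → z * (a - b)) Λt Λs ⟩
          z * (0# - 0#)
            ≡⟨ solve 1 (λ z → z :* (con (ℤ.+ 0) :- con (ℤ.+ 0)) := con (ℤ.+ 0)) refl z ⟩
          0# ∎
        Λo≡0 : Λ x o ≡ 0#
        Λo≡0 = begin
          Λ x o                                     ≡⟨ solve 3 (λ o s e → o := (o :- s :* e) :+ s :* e) refl (Λ x o) s (slope x v) ⟩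
          (Λ x o - s * slope x v) + s * slope x v   ≡⟨ cong₂ (λ a b → a + s * b) Λs slope≡0′ ⟩
          0# + s * 0#                               ≡⟨ trans (+-identityˡ _) (zeroʳ s) ⟩
          0#                                        ∎

-- Counting and inequalities

open import Data.Integer.Base using (+_)
open import Data.Nat.Base using (_+_; _*_; _∸_; _^_; _⊔_)

module Counting where

  private variable
    A B : Set

  -- The head of `xs` is cut out of `ys`; being distinct from the head, the other elements of `xs`
  -- all survive in what is left.
  unique-⊆⇒length-≤ : {xs ys : List A} → Unique xs → (∀ {a} → a ∈ xs → a ∈ ys) →
                      length xs ≤ length ys
  unique-⊆⇒length-≤ {xs = []}     _            _  = z≤n
  unique-⊆⇒length-≤ {xs = x ∷ xs} (x∉xs ∷ xs!) xs⊆ys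
    with us , vs , refl ← ∈-∃++ (xs⊆ys (here refl)) =
    subst (suc (length xs) ≤_) (sym (length-++-sucʳ us x vs))
      (s≤s (unique-⊆⇒length-≤ xs! xs⊆us++vs))
    where
    xs⊆us++vs : ∀ {a} → a ∈ xs → a ∈ us ++ vs
    xs⊆us++vs a∈xs with ∈-++⁻ us (xs⊆ys (there a∈xs))
    ... | inj₁ a∈us         = ∈-++⁺ˡ a∈us
    ... | inj₂ (here refl)  = contradiction refl (All.lookup x∉xs a∈xs)
    ... | inj₂ (there a∈vs) = ∈-++⁺ʳ us a∈vs

  length-filter-∁ : {P : Pred A 0ℓ} (P? : Decidable P) (xs : List A) →
                    length (filter P? xs) + length (filter (¬? ∘ P?) xs) ≡ length xs
  length-filter-∁ P? []       = refl
  length-filter-∁ P? (x ∷ xs) with P? x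
  ... | yes _ = cong suc (length-filter-∁ P? xs)
  ... | no  _ = trans (ℕ.+-suc _ _) (cong suc (length-filter-∁ P? xs))

  length-cartesianProduct : (xs : List A) (ys : List B) →
                            length (cartesianProduct xs ys) ≡ length xs * length ys
  length-cartesianProduct []       ys = refl
  length-cartesianProduct (x ∷ xs) ys = trans (length-++ (map (x ,_) ys))
    (cong₂ _+_ (length-map (x ,_) ys) (length-cartesianProduct xs ys))

  length-filter-map : {P : Pred B 0ℓ} (P? : Decidable P) (f : A → B) (xs : List A) →
                      length (filter P? (map f xs)) ≡ length (filter (P? ∘ f) xs)
  length-filter-map P? f []       = refl
  length-filter-map P? f (x ∷ xs) with P? (f x)
  ... | yes _ = cong suc (length-filter-map P? f xs)
  ... | no  _ = length-filter-map P? f xs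

  module _ {R : REL A B 0ℓ} (R? : B.Decidable R) where

    filter-cartesianProduct-≥ : ∀ {k} (xs : List A) (ys : List B) →
      (∀ {x} → x ∈ xs → k ≤ length (filter (R? x) ys)) →
      length xs * k ≤ length (filter (uncurry R?) (cartesianProduct xs ys))
    filter-cartesianProduct-≥     []       ys k≤ = z≤n
    filter-cartesianProduct-≥ {k} (x ∷ xs) ys k≤ = begin
      k + length xs * k
        ≤⟨ ℕ.+-mono-≤ (k≤ (here refl)) (filter-cartesianProduct-≥ xs ys (k≤ ∘ there)) ⟩
      length (filter (R? x) ys) + length (filter (uncurry R?) (cartesianProduct xs ys))
        ≡⟨ cong (_+ length (filter (uncurry R?) (cartesianProduct xs ys))) (length-filter-map (uncurry R?) (x ,_) ys) ⟨
      length (filter (uncurry R?) (map (x ,_) ys)) + length (filter (uncurry R?) (cartesianProduct xs ys))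
        ≡⟨ length-++ (filter (uncurry R?) (map (x ,_) ys)) ⟨
      length (filter (uncurry R?) (map (x ,_) ys) ++ filter (uncurry R?) (cartesianProduct xs ys))
        ≡⟨ cong length (filter-++ (uncurry R?) (map (x ,_) ys) (cartesianProduct xs ys)) ⟨
      length (filter (uncurry R?) (map (x ,_) ys ++ cartesianProduct xs ys)) ∎
      where open ℕ.≤-Reasoning

  module _ {R : REL A B 0ℓ} (R? : B.Decidable R) where

    degree : List A → B → ℕ
    degree xs y = length (filter (λ x → R? x y) xs)

    degree-mono : ∀ {xs xs′ : List A} → Unique xs → (∀ {a} → a ∈ xs → a ∈ xs′) →
                  ∀ y → degree xs y ≤ degree xs′ y
    degree-mono xs! xs⊆xs′ y = unique-⊆⇒length-≤ (Unique.filter⁺ _ xs!) λ a∈ →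
      let a∈xs , Ray = ∈-filter⁻ (λ x → R? x y) a∈ in ∈-filter⁺ (λ x → R? x y) (xs⊆xs′ a∈xs) Ray

    -- An element of least degree is taken. Its degree times the length of `ts` is at most the sum
    -- of all degrees over `ts`, which counts some of the pairs on the right.
    belowAverageDegree : {xs : List A} {ys ts : List B} → Unique xs → Unique ts →
      (∀ {t} → t ∈ ts → t ∈ ys) → 0 < length ts →
      ∃[ t ] t ∈ ts × length ts * degree xs t ≤ length (filter (uncurry R?) (cartesianProduct xs ys))
    belowAverageDegree {xs} {ys} {ts@(t₀ ∷ ts′)} xs! ts! ts⊆ys _ = t , t∈ts , (begin
      length ts * degree xs t
        ≤⟨ filter-cartesianProduct-≥ (flip R?) ts xs minimal ⟩
      length (filter (uncurry (flip R?)) (cartesianProduct ts xs))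
        -- The degrees are row counts of `ts` × `xs`, whereas the total refers to `xs` × `ys`.
        -- Exchanging components is injective and lands there because `ts` is contained in `ys`.
        ≡⟨ length-map swap (filter (uncurry (flip R?)) (cartesianProduct ts xs)) ⟨
      length (map swap (filter (uncurry (flip R?)) (cartesianProduct ts xs)))
        ≤⟨ unique-⊆⇒length-≤
             (Unique.map⁺ (cong swap) (Unique.filter⁺ _ (Unique.cartesianProduct⁺ ts! xs!))) swapped∈ ⟩
      length (filter (uncurry R?) (cartesianProduct xs ys)) ∎)
      where
      open ℕ.≤-Reasoning
      t = Extrema.argmin (degree xs) t₀ ts′
      t∈ts : t ∈ ts
      t∈ts with Extrema.argmin-sel (degree xs) t₀ ts′
      ... | inj₁ t≡t₀  = here t≡t₀
      ... | inj₂ t∈ts′ = there t∈ts′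
      minimal : ∀ {y} → y ∈ ts → degree xs t ≤ degree xs y
      minimal (here refl) = Extrema.f[argmin]≤f[⊤] {f = degree xs} t₀ ts′
      minimal (there y∈)  = All.lookup (Extrema.f[argmin]≤f[xs] {f = degree xs} t₀ ts′) y∈
      swapped∈ : ∀ {a} → a ∈ map swap (filter (uncurry (flip R?)) (cartesianProduct ts xs)) →
                 a ∈ filter (uncurry R?) (cartesianProduct xs ys)
      swapped∈ a∈ with (y , x) , yx∈ , refl ← ∈-map⁻ swap a∈
        with yx∈′ , Rxy ← ∈-filter⁻ (uncurry (flip R?)) {xs = cartesianProduct ts xs} yx∈
        with y∈ts , x∈xs ← ∈-cartesianProduct⁻ ts xs yx∈′ =
        ∈-filter⁺ (uncurry R?) (∈-cartesianProduct⁺ x∈xs (ts⊆ys y∈ts)) Rxy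

-- Inequalities for δ² = D E / (m n), cleared of roots and denominators

module Inequalities where
  open ℕ.≤-Reasoning
  open +-*-Solver

  *-self-mono-≤ : ∀ {a b} → a ≤ b → a * a ≤ b * b
  *-self-mono-≤ a≤b = ℕ.*-mono-≤ a≤b a≤b

  -- In real terms: T > δ n and e ≤ E / T give D e ≤ D E / (δ n) = δ m. The proof multiplies the
  -- squared claim by E and uses each hypothesis once.
  belowAverage-bound : ∀ D {E T e m n} → T * e ≤ E → D * E * n < T * T * m →
                       (D * e) * (D * e) * n ≤ D * E * m
  -- Cancelling E requires E ≠ 0. For E = 0 the strict inequality excludes T = 0, and then T e ≤ 0
  -- leaves only e = 0.
  belowAverage-bound D {zero}    {zero}  _    DEn<0 = contradiction DEn<0 ℕ.n≮0
  belowAverage-bound D {zero}    {suc T} {zero} {m} {n} _ _ = begin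
    D * 0 * (D * 0) * n  ≡⟨ cong (λ z → z * z * n) (ℕ.*-zeroʳ D) ⟩
    0                    ≤⟨ z≤n ⟩
    D * 0 * m            ∎
  belowAverage-bound D {E@(suc _)} {T} {e} {m} {n} Te≤E DEn<TTm = ℕ.*-cancelʳ-≤ _ _ E (begin
    (D * e) * (D * e) * n * E  ≡⟨ solve 4 (λ D e n E → D :* e :* (D :* e) :* n :* E
                                    := D :* e :* e :* (D :* E :* n)) refl D e n E ⟩
    D * e * e * (D * E * n)    ≤⟨ ℕ.*-monoʳ-≤ (D * e * e) (ℕ.<⇒≤ DEn<TTm) ⟩
    D * e * e * (T * T * m)    ≡⟨ solve 4 (λ D e T m → D :* e :* e :* (T :* T :* m)
                                    := D :* m :* ((T :* e) :* (T :* e))) refl D e T m ⟩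
    D * m * (T * e * (T * e))  ≤⟨ ℕ.*-monoʳ-≤ (D * m) (*-self-mono-≤ Te≤E) ⟩
    D * m * (E * E)            ≡⟨ solve 3 (λ D m E → D :* m :* (E :* E) := D :* E :* m :* E) refl D m E ⟩
    D * E * m * E              ∎)

  -- In real terms: D e ≤ δ m and (D + 1) δ < D. If (D + 1) e reached m, squaring and multiplying by
  -- D² n would give a number below itself.
  suc-D*e<m : ∀ D .{{_ : ℕ.NonZero D}} {E e m n} .{{_ : ℕ.NonZero m}} →
              (D * e) * (D * e) * n ≤ D * E * m → E * (suc D * suc D) < D * (m * n) →
              suc D * e < m
  suc-D*e<m D {E} {e} {m} {n} De²n≤DEm E-small with suc D * e ℕ.<? m
  ... | yes <m = <m
  ... | no  ≮m = contradiction (begin-strict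
    D * D * n * (m * m)                    ≤⟨ ℕ.*-monoʳ-≤ (D * D * n) (*-self-mono-≤ (ℕ.≮⇒≥ ≮m)) ⟩
    D * D * n * (suc D * e * (suc D * e))  ≡⟨ solve 4 (λ D n e S → D :* D :* n :* (S :* e :* (S :* e))
                                                := S :* S :* (D :* e :* (D :* e) :* n)) refl D n e (suc D) ⟩
    suc D * suc D * (D * e * (D * e) * n)  ≤⟨ ℕ.*-monoʳ-≤ (suc D * suc D) De²n≤DEm ⟩
    suc D * suc D * (D * E * m)            ≡⟨ solve 4 (λ D E m S → S :* S :* (D :* E :* m)
                                                := D :* m :* (E :* (S :* S))) refl D E m (suc D) ⟩
    D * m * (E * (suc D * suc D))          <⟨ ℕ.*-monoʳ-< (D * m) {{ℕ.m*n≢0 D m}} E-small ⟩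
    D * m * (D * (m * n))                  ≡⟨ solve 3 (λ D m n → D :* m :* (D :* (m :* n))
                                                := D :* D :* n :* (m :* m)) refl D m n ⟩
    D * D * n * (m * m)                    ∎) (ℕ.<-irrefl refl)

  -- In real terms δ < 1, a weakening of δ < D / (D + 1).
  D*E<m*n : ∀ D .{{_ : ℕ.NonZero D}} {E m n} → E * (suc D * suc D) < D * (m * n) → D * E < m * n
  D*E<m*n D {E} {m} {n} E-small = ℕ.*-cancelˡ-< D _ _ (begin-strict
    D * (D * E)          ≡⟨ solve 2 (λ D E → D :* (D :* E) := E :* (D :* D)) refl D E ⟩
    E * (D * D)          ≤⟨ ℕ.*-monoʳ-≤ E (*-self-mono-≤ (ℕ.n≤1+n D)) ⟩
    E * (suc D * suc D)  <⟨ E-small ⟩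
    D * (m * n)          ∎)

-- Fractions of natural numbers

module Fractions where

  infix 8 _//_
  _//_ : ℕ → (n : ℕ) .{{_ : ℕ.NonZero n}} → ℚ
  a // n = ℤ.+ a ℚ./ n

  -- Rationals are stored in lowest terms, which hides a and n; passing to unnormalised fractions
  -- reduces comparisons to cross multiplication.
  toℚᵘ-// : ∀ a n → toℚᵘ (a // suc n) ℚᵘ.≃ mkℚᵘ (ℤ.+ a) n
  toℚᵘ-// a n = ℚ.toℚᵘ-fromℚᵘ (mkℚᵘ (ℤ.+ a) n)

  pos-* : ∀ {a b c d} → a ℕ.* b ≡ c ℕ.* d → ℤ.+ a ℤ.* ℤ.+ b ≡ ℤ.+ c ℤ.* ℤ.+ d
  pos-* {a} {b} {c} {d} eq = trans (sym (ℤ.pos-* a b)) (trans (cong ℤ.+_ eq) (ℤ.pos-* c d))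

  //-≡ : ∀ {a b c d} .{{_ : ℕ.NonZero b}} .{{_ : ℕ.NonZero d}} →
         a ℕ.* d ≡ c ℕ.* b → a // b ≡ c // d
  //-≡ {a} {suc b} {c} {suc d} eq = ℚ.fromℚᵘ-cong {mkℚᵘ (ℤ.+ a) b} {mkℚᵘ (ℤ.+ c) d}
    (*≡* (pos-* {a} {suc d} {c} {suc b} eq))

  //-mono-≤ : ∀ {a b c d} .{{_ : ℕ.NonZero b}} .{{_ : ℕ.NonZero d}} →
              a ℕ.* d ≤ c ℕ.* b → a // b ℚ.≤ c // d
  //-mono-≤ {a} {suc b} {c} {suc d} le = ℚ.toℚᵘ-cancel-≤
    (ℚᵘ.≤-respˡ-≃ (ℚᵘ.≃-sym (toℚᵘ-// a b)) (ℚᵘ.≤-respʳ-≃ (ℚᵘ.≃-sym (toℚᵘ-// c d))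
      (*≤* (subst₂ ℤ._≤_ (ℤ.pos-* a (suc d)) (ℤ.pos-* c (suc b)) (ℤ.+≤+ le)))))

  //-mono-< : ∀ {a b c d} .{{_ : ℕ.NonZero b}} .{{_ : ℕ.NonZero d}} →
              a ℕ.* d < c ℕ.* b → a // b ℚ.< c // d
  //-mono-< {a} {suc b} {c} {suc d} lt = ℚ.toℚᵘ-cancel-<
    (ℚᵘ.<-respˡ-≃ (ℚᵘ.≃-sym (toℚᵘ-// a b)) (ℚᵘ.<-respʳ-≃ (ℚᵘ.≃-sym (toℚᵘ-// c d))
      (*<* (subst₂ ℤ._<_ (ℤ.pos-* a (suc d)) (ℤ.pos-* c (suc b)) (ℤ.+<+ lt)))))

  //-cancel-< : ∀ {a b c d} .{{_ : ℕ.NonZero b}} .{{_ : ℕ.NonZero d}} →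
                a // b ℚ.< c // d → a ℕ.* d < c ℕ.* b
  //-cancel-< {a} {b} {c} {d} lt with a ℕ.* d ℕ.<? c ℕ.* b
  ... | yes ad<cb = ad<cb
  ... | no  ad≮cb = contradiction (ℚ.<-≤-trans lt (//-mono-≤ {c} {d} {a} {b} (ℕ.≮⇒≥ ad≮cb))) (ℚ.<-irrefl refl)

  //-* : ∀ a b c d .{{_ : ℕ.NonZero b}} .{{_ : ℕ.NonZero d}} .{{_ : ℕ.NonZero (b ℕ.* d)}} →
         a // b ℚ.* c // d ≡ (a ℕ.* c) // (b ℕ.* d)
  //-* a (suc b) c (suc d) = ℚ.toℚᵘ-injective (ℚᵘ.≃-trans (ℚ.toℚᵘ-homo-* (a // suc b) (c // suc d))
    (ℚᵘ.≃-trans (ℚᵘ.*-cong (toℚᵘ-// a b) (toℚᵘ-// c d))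
      (ℚᵘ.≃-trans (*≡* (cong (ℤ._* ℤ.+ (suc b ℕ.* suc d)) (sym (ℤ.pos-* a c))))
        (ℚᵘ.≃-sym (toℚᵘ-// (a ℕ.* c) _)))))

  //-complement : ∀ a b n .{{_ : ℕ.NonZero n}} → a ℕ.+ b ≡ n → 1ℚ ℚ.- a // n ≡ b // n
  //-complement a b n@(suc n-1) a+b≡n = begin
    1ℚ ℚ.- a // n                    ≡⟨ cong (ℚ._- a // n) sum ⟨
    (b // n ℚ.+ a // n) ℚ.- a // n   ≡⟨ //-rightDividesʳ ℚ.+-0-group (a // n) (b // n) ⟩
    b // n                           ∎
    where
    open ≡-Reasoning
    sum : b // n ℚ.+ a // n ≡ 1ℚ
    sum = ℚ.toℚᵘ-injective (ℚᵘ.≃-trans (ℚ.toℚᵘ-homo-+ (b // n) (a // n))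
      (ℚᵘ.≃-trans (ℚᵘ.+-cong (toℚᵘ-// b n-1) (toℚᵘ-// a n-1)) (*≡* (begin
        (ℤ.+ b ℤ.* ℤ.+ n ℤ.+ ℤ.+ a ℤ.* ℤ.+ n) ℤ.* ℤ.+ 1
          ≡⟨ ℤ.*-identityʳ _ ⟩
        ℤ.+ b ℤ.* ℤ.+ n ℤ.+ ℤ.+ a ℤ.* ℤ.+ n
          ≡⟨ ℤ.*-distribʳ-+ (ℤ.+ n) (ℤ.+ b) (ℤ.+ a) ⟨
        (ℤ.+ b ℤ.+ ℤ.+ a) ℤ.* ℤ.+ n
          ≡⟨ cong (λ k → ℤ.+ k ℤ.* ℤ.+ n) (trans (ℕ.+-comm b a) a+b≡n) ⟩
        ℤ.+ n ℤ.* ℤ.+ n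
          ≡⟨ ℤ.pos-* n n ⟨
        ℤ.+ (n ℕ.* n)
          ≡⟨ ℤ.*-identityˡ _ ⟨
        ℤ.+ 1 ℤ.* ℤ.+ (n ℕ.* n) ∎))))

  ℕ→ℚ-mono-≤ : ∀ {a b} → a ≤ b → ℕ→ℚ a ℚ.≤ ℕ→ℚ b
  ℕ→ℚ-mono-≤ {a} {b} a≤b = //-mono-≤ {a} {1} {b} {1} (ℕ.*-monoˡ-≤ 1 a≤b)

  ℕ→ℚ-cancel-< : ∀ {a b} → ℕ→ℚ a ℚ.< ℕ→ℚ b → a < b
  ℕ→ℚ-cancel-< {a} {b} lt = subst₂ _<_ (ℕ.*-identityʳ a) (ℕ.*-identityʳ b) (//-cancel-< {a} {1} {b} {1} lt)

  //-*-denominator : ∀ a n .{{_ : ℕ.NonZero n}} → a // n ℚ.* ℕ→ℚ n ≡ ℕ→ℚ a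
  //-*-denominator a n@(suc _) = trans (//-* a n n 1)
    (//-≡ {a ℕ.* n} {n ℕ.* 1} {a} {1} (trans (ℕ.*-identityʳ _) (cong (a ℕ.*_) (sym (ℕ.*-identityʳ n)))))

  //-nonNeg : ∀ a n .{{_ : ℕ.NonZero n}} → 0ℚ ℚ.≤ a // n
  //-nonNeg a n = ℚ.nonNegative⁻¹ (a // n) {{ℚ.normalize-nonNeg a n}}

  1-involutive : ∀ p → 1ℚ ℚ.- (1ℚ ℚ.- p) ≡ p
  1-involutive p = begin
    1ℚ ℚ.- (1ℚ ℚ.- p)                ≡⟨ cong (1ℚ ℚ.+_) (ℚ.neg-distrib-+ 1ℚ (ℚ.- p)) ⟩
    1ℚ ℚ.+ (ℚ.- 1ℚ ℚ.- (ℚ.- p))      ≡⟨ ℚ.+-assoc 1ℚ (ℚ.- 1ℚ) (ℚ.- (ℚ.- p)) ⟨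
    0ℚ ℚ.- (ℚ.- p)                   ≡⟨ ℚ.+-identityˡ _ ⟩
    ℚ.- (ℚ.- p)                      ≡⟨ ⁻¹-involutive ℚ.+-0-group p ⟩
    p                                ∎
    where open ≡-Reasoning

  1-antimono-< : ∀ {p q} → p ℚ.< q → 1ℚ ℚ.- q ℚ.< 1ℚ ℚ.- p
  1-antimono-< p<q = ℚ.+-monoʳ-< 1ℚ (ℚ.neg-antimono-< p<q)

  1-antimono-≤ : ∀ {p q} → p ℚ.≤ q → 1ℚ ℚ.- q ℚ.≤ 1ℚ ℚ.- p
  1-antimono-≤ p≤q = ℚ.+-monoʳ-≤ 1ℚ (ℚ.neg-antimono-≤ p≤q)

  <1-swap : ∀ {p q} → p ℚ.< 1ℚ ℚ.- q → q ℚ.< 1ℚ ℚ.- p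
  <1-swap {p} {q} p<1-q = subst (ℚ._< 1ℚ ℚ.- p) (1-involutive q) (1-antimono-< p<1-q)

  square-cancel-≤ : ∀ {s t} → 0ℚ ℚ.≤ s → t ℚ.* t ℚ.≤ s ℚ.* s → t ℚ.≤ s
  square-cancel-≤ {s} {t} 0≤s tt≤ss with t ℚ.≤? s
  ... | yes t≤s = t≤s
  ... | no  t≰s = contradiction (ℚ.<-≤-trans ss<tt tt≤ss) (ℚ.<-irrefl refl)
    where
    s<t = ℚ.≰⇒> t≰s
    ss<tt : s ℚ.* s ℚ.< t ℚ.* t
    ss<tt = ℚ.≤-<-trans
      (ℚ.*-monoˡ-≤-nonNeg s {{ℚ.nonNegative 0≤s}} (ℚ.<⇒≤ s<t))
      (ℚ.*-monoˡ-<-pos t {{ℚ.positive (ℚ.≤-<-trans 0≤s s<t)}} s<t)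

-- Sizes compared with real multiples

module Proportions where
  open Fractions
  open ℝ

  lower<upper : ∀ (x : ℝ) {p q} → lower x p → upper x q → p ℚ.< q
  lower<upper x {p} {q} xp xq with p ℚ.<? q
  ... | yes p<q = p<q
  ... | no  p≮q with r , p<r , xr ← lower-rounded x xp =
    contradiction (upper-closed x (ℚ.≤-<-trans (ℚ.≮⇒≥ p≮q) p<r) xq) (disjoint x xr)

  -- Here l elements are lost and (l / m)² ≤ A / N. A rational p below 1 - √(A / N) comes with some
  -- s < 1 - p that bounds the root from above; comparing squares gives l / m ≤ s, hence p m ≤ c.
  large : ∀ {c l m A N} .{{_ : ℕ.NonZero m}} .{{_ : ℕ.NonZero N}} →
          l ℕ.+ c ≡ m → l ℕ.* l ℕ.* N ≤ A ℕ.* (m ℕ.* m) →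
          ℕ→ℝ c ≥ℝ (1- √ (A // N)) ·ℕ m
  large {c} {l} {m@(suc _)} {A} {N} l+c≡m llN≤Amm q (p , (s , s<1-p , 0≤s , r≤ss) , q<pm) =
    ℚ.<-≤-trans q<pm (begin
      p ℚ.* ℕ→ℚ m                  ≤⟨ *m-mono {p} (ℚ.<⇒≤ (<1-swap {s} s<1-p)) ⟩
      (1ℚ ℚ.- s) ℚ.* ℕ→ℚ m         ≤⟨ *m-mono (1-antimono-≤ t≤s) ⟩
      (1ℚ ℚ.- l // m) ℚ.* ℕ→ℚ m    ≡⟨ cong (ℚ._* ℕ→ℚ m) (//-complement l c m l+c≡m) ⟩
      c // m ℚ.* ℕ→ℚ m             ≡⟨ //-*-denominator c m ⟩
      ℕ→ℚ c                        ∎)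
    where
    open ℚ.≤-Reasoning
    *m-mono : ∀ {a b} → a ℚ.≤ b → a ℚ.* ℕ→ℚ m ℚ.≤ b ℚ.* ℕ→ℚ m
    *m-mono = ℚ.*-monoʳ-≤-nonNeg (ℕ→ℚ m) {{ℚ.normalize-nonNeg m 1}}
    t≤s : l // m ℚ.≤ s
    t≤s = square-cancel-≤ 0≤s (begin
      l // m ℚ.* l // m              ≡⟨ //-* l m l m ⟩
      (l ℕ.* l) // (m ℕ.* m)         ≤⟨ //-mono-≤ {l ℕ.* l} {m ℕ.* m} {A} {N} llN≤Amm ⟩
      A // N                         ≤⟨ r≤ss ⟩
      s ℚ.* s                        ∎)

  -- A rational q between δ and γ separates the two sizes: a exceeds (1 - q) m, while b cannot.
  large-<-absurd : ∀ {δ γ : ℝ} {a b m} .{{_ : ℕ.NonZero m}} → δ <ℝ γ → a ≤ b →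
                   ℕ→ℝ a ≥ℝ (1- δ) ·ℕ m → ℕ→ℝ b ≤ℝ (1- γ) ·ℕ m → ⊥
  large-<-absurd {δ} {γ} {a} {b} {m@(suc _)} (q , δq , γq) a≤b a-large b-small
    -- A scaled cut asks for a strict inequality; the room is provided by q′ < q still above δ.
    with q′ , q′<q , δq′ ← upper-rounded δ δq
    with p , γp , <pm ← b-small ((1ℚ ℚ.- q) ℚ.* ℕ→ℚ m) (ℚ.<-≤-trans
           (a-large ((1ℚ ℚ.- q) ℚ.* ℕ→ℚ m)
             (1ℚ ℚ.- q′ , subst (upper δ) (sym (1-involutive q′)) δq′
             , ℚ.*-monoˡ-<-pos (ℕ→ℚ m) {{ℚ.normalize-pos m 1}} (1-antimono-< q′<q)))
           (ℕ→ℚ-mono-≤ a≤b)) =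
    ℚ.<-irrefl refl (ℚ.<-trans <pm
      (ℚ.*-monoˡ-<-pos (ℕ→ℚ m) {{ℚ.normalize-pos m 1}} {p} (<1-swap {q} {p} (lower<upper γ γq γp))))

  -- Any u between s and 1 lies above √r, so the positive number (1 - u) m puts 0 into the lower cut
  -- of (1 - √r) m.
  large⇒positive : ∀ {r s : ℚ} {a m} .{{_ : ℕ.NonZero m}} →
                   0ℚ ℚ.≤ s → s ℚ.< 1ℚ → r ℚ.≤ s ℚ.* s → ℕ→ℝ a ≥ℝ (1- √ r) ·ℕ m → 0 < a
  large⇒positive {r} {s} {a} {m@(suc _)} 0≤s s<1 r≤ss a-large with u , s<u , u<1 ← ℚ.<-dense s<1 =
    ℕ→ℚ-cancel-< {0} {a} (a-large 0ℚ (1ℚ ℚ.- u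
      , (s , subst (s ℚ.<_) (sym (1-involutive u)) s<u , 0≤s , r≤ss)
      , subst (ℚ._< (1ℚ ℚ.- u) ℚ.* ℕ→ℚ m) (ℚ.*-zeroˡ (ℕ→ℚ m))
          (ℚ.*-monoˡ-<-pos (ℕ→ℚ m) {{ℚ.normalize-pos m 1}} (1-antimono-< u<1))))

  large-trans-< : ∀ {x : ℝ} {a b} → ℕ→ℝ a ≥ℝ x → x ≥ℝ ℕ→ℝ (suc b) → b < a
  large-trans-< {x} {a} {b} a≥x x≥b = ℕ→ℚ-cancel-<
    (a≥x (ℕ→ℚ b) (x≥b (ℕ→ℚ b) (//-mono-< {b} {1} {suc b} {1} (ℕ.*-monoˡ-< 1 (ℕ.n<1+n b)))))

-- The greedy choice of spheres

module Classification {q k : ℕ} (F : FiniteField q)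
  (Q : VectorSpace.QuadraticForm F (2 + k)) (nondegenerate : VectorSpace.QuadraticForm.Nondegenerate Q)
  (P : FinSubset (Spheres.Point F Q)) (𝒮 : FinSubset (Spheres.Sphere F Q))
  .{{_ : NonZero ∣ P ∣}} .{{_ : NonZero ∣ 𝒮 ∣}}
  where

  open VectorSpace F
  open LinearAlgebra F
  open Spheres F Q
  open SphereGeometry F Q nondegenerate
  open Counting
  open Inequalities
  open Fractions
  open Proportions
  open FinSubset
  open +-*-Solver using (solve; _:*_; _:=_)

  private
    d = 2 + k
    D = suc d
    m = ∣ P ∣
    n = ∣ 𝒮 ∣
    instance
      mn≢0 : NonZero (m * n)
      mn≢0 = ℕ.m*n≢0 m n

  misses : ∀ x S → _
  misses x S = ¬? (x ∈ˢ? S)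

  -- The count is kept opaque, so that the inequalities below treat E as an arbitrary natural number
  -- and do not unfold a filtered product.
  abstract
    nonIncidences : ℕ
    nonIncidences = length (filter (uncurry misses) (cartesianProduct (elements P) (elements 𝒮)))

    I+nonIncidences≡mn : I P 𝒮 + nonIncidences ≡ m * n
    I+nonIncidences≡mn =
      trans (length-filter-∁ (λ (x , S) → x ∈ˢ? S) (cartesianProduct (elements P) (elements 𝒮)))
            (length-cartesianProduct (elements P) (elements 𝒮))

    fewMisses : (𝒯 : FinSubset Sphere) → 𝒯 ⊆ᶠ 𝒮 → 0 < ∣ 𝒯 ∣ →
                ∃[ S ] S ∈ᶠ 𝒯 × ∣ 𝒯 ∣ * degree misses (elements P) S ≤ nonIncidences
    fewMisses 𝒯 𝒯⊆𝒮 = belowAverageDegree misses (unique P) (unique 𝒯) 𝒯⊆𝒮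

  private
    E = nonIncidences

  μ≡E/mn : μ P 𝒮 ≡ E // (m * n)
  μ≡E/mn = //-complement (I P 𝒮) E (m * n) I+nonIncidences≡mn

  δ² : ℚ
  δ² = ℕ→ℚ (d + 1) ℚ.* μ P 𝒮

  δ²≡DE/mn : δ² ≡ (D * E) // (m * n)
  δ²≡DE/mn = trans (cong (ℕ→ℚ (d + 1) ℚ.*_) μ≡E/mn) (trans (//-* (d + 1) 1 E (m * n) {{_}} {{mn≢0}} {{ℕ.m*n≢0 1 (m * n)}})
    (//-≡ {(d + 1) * E} {1 * (m * n)} {D * E} {m * n} {{ℕ.m*n≢0 1 (m * n)}}
      (cong₂ (λ a b → a * E * b) (ℕ.+-comm d 1) (sym (ℕ.*-identityˡ (m * n))))))

  module _ (μ< : μ P 𝒮 ℚ.< + (d + 1) ℚ./ ((2 + d) ^ 2)) where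

    E-small : E * (suc D * suc D) < D * (m * n)
    E-small = subst₂ (λ a b → E * (suc D * a) < b * (m * n)) (ℕ.*-identityʳ (suc D)) (ℕ.+-comm d 1)
      (//-cancel-< {E} {m * n} {d + 1} {(2 + d) ^ 2} (subst (ℚ._< _) μ≡E/mn μ<))

    -- The hypothesis on μ gives δ² = D μ < (D / (D + 1))², so D / (D + 1) is a rational bound for δ
    -- below 1.
    large⇒nonempty : ∀ {a} → ℕ→ℝ a ≥ℝ (1- √ δ²) ·ℕ m → 0 < a
    large⇒nonempty = large⇒positive {δ²} {D // suc D} (//-nonNeg D (suc D))
      (//-mono-< {D} {suc D} {1} {1} (ℕ.≤-reflexive (cong suc (trans (ℕ.*-identityʳ D) (sym (ℕ.+-identityʳ D))))))
      (subst₂ ℚ._≤_ (sym δ²≡DE/mn) (sym (//-* D (suc D) D (suc D)))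
        (//-mono-≤ {D * E} {m * n} {D * D} {suc D * suc D} (begin
          D * E * (suc D * suc D)    ≡⟨ ℕ.*-assoc D E (suc D * suc D) ⟩
          D * (E * (suc D * suc D))  ≤⟨ ℕ.*-monoʳ-≤ D (ℕ.<⇒≤ E-small) ⟩
          D * (D * (m * n))          ≡⟨ ℕ.*-assoc D D (m * n) ⟨
          D * D * (m * n)            ∎)))
      where open ℕ.≤-Reasoning

    -- e / m ≤ δ / D
    record Bounded (e : ℕ) : Set where
      constructor bound
      field De²n≤DEm : (D * e) * (D * e) * n ≤ D * E * m
    open Bounded

    Bounded-⊔ : ∀ {e e′} → Bounded e → Bounded e′ → Bounded (e ⊔ e′)
    Bounded-⊔ {e} {e′} b b′ = [ (λ eq → subst Bounded (sym eq) b) , (λ eq → subst Bounded (sym eq) b′) ]′ (ℕ.⊔-sel e e′)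

    -- Invariant of the greedy choice. A single `e` bounds the loss of every step so far: the
    -- condition `Bounded` passes to maxima, so the losses need not be recorded one by one and the
    -- total is at most `steps * e`.
    record Partial (L : AffineSubspace (suc d)) (steps : ℕ) : Set where
      field
        P₀      : FinSubset Point
        P₀⊆P    : P₀ ⊆ᶠ P
        P₀⊆B    : ∀ {x} → x ∈ᶠ P₀ → B⟨ L ⟩ x
        e       : ℕ
        bounded : Bounded e
        loss    : m ≤ ∣ P₀ ∣ + steps * e

    onSphere : FinSubset Point → Sphere → FinSubset Point
    onSphere X S = record { elements = filter (_∈ˢ? S) (elements X) ; unique = Unique.filter⁺ (_∈ˢ? S) (unique X) }

    ∈-onSphere : ∀ X S {x} → x ∈ᶠ onSphere X S → x ∈ᶠ X × x ∈ˢ S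
    ∈-onSphere X S = ∈-filter⁻ (_∈ˢ? S)

    -- Misses are counted in all of `P`, the set to which the averaging bound refers; they dominate
    -- the misses among the points that still survive.
    onSphere-loss : ∀ X S → X ⊆ᶠ P → ∣ X ∣ ≤ ∣ onSphere X S ∣ + degree misses (elements P) S
    onSphere-loss X S X⊆P = begin
      ∣ X ∣                                              ≡⟨ length-filter-∁ (_∈ˢ? S) (elements X) ⟨
      ∣ onSphere X S ∣ + degree misses (elements X) S    ≤⟨ ℕ.+-monoʳ-≤ ∣ onSphere X S ∣ (degree-mono misses (unique X) X⊆P S) ⟩
      ∣ onSphere X S ∣ + degree misses (elements P) S    ∎
      where open ℕ.≤-Reasoning

    -- The hypothesis on 𝒯 says ∣ 𝒯 ∣ > δ n.
    chooseSphere : (𝒯 : FinSubset Sphere) → 𝒯 ⊆ᶠ 𝒮 → D * E * n < ∣ 𝒯 ∣ * ∣ 𝒯 ∣ * m →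
                   ∃[ S ] S ∈ᶠ 𝒯 × Bounded (degree misses (elements P) S)
    chooseSphere 𝒯 𝒯⊆𝒮 many =
      let S , S∈𝒯 , below = fewMisses 𝒯 𝒯⊆𝒮 (positive ∣ 𝒯 ∣ many)
      in S , S∈𝒯 , bound (belowAverage-bound D {E} {∣ 𝒯 ∣} {degree misses (elements P) S} {m} {n} below many)
      where
      positive : ∀ t → D * E * n < t * t * m → 0 < t
      positive zero    lt = contradiction lt ℕ.n≮0
      positive (suc t) _  = s≤s z≤n

    start : ∃[ L ] dim L ≡ 0 × Partial L 1
    start =
      let S , _ , bounded = chooseSphere 𝒮 (λ S∈ → S∈) all-many in
      singleton (Φ S) , refl , record
      { P₀ = onSphere P S ; P₀⊆P = λ x∈ → proj₁ (∈-onSphere P S x∈)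
      ; P₀⊆B = λ {x} x∈ → B-singleton (Φ S) (∈ˢ⇒Λ≡0 x S (proj₂ (∈-onSphere P S x∈)))
      ; e = degree misses (elements P) S ; bounded = bounded
      ; loss = ℕ.≤-trans (onSphere-loss P S λ x∈ → x∈)
          (ℕ.+-monoʳ-≤ ∣ onSphere P S ∣ (ℕ.m≤m+n (degree misses (elements P) S) 0))
      }
      where
      open ℕ.≤-Reasoning
      -- Since δ < 1, the whole family exceeds the threshold δ n. The first choice yields a single
      -- point, so the number of choices is dim L + 1 from here on.
      all-many : D * E * n < n * n * m
      all-many = begin-strict
        D * E * n    <⟨ ℕ.*-monoˡ-< n (D*E<m*n D {E} {m} {n} E-small) ⟩
        m * n * n    ≡⟨ ℕ.*-assoc m n n ⟩
        m * (n * n)  ≡⟨ ℕ.*-comm m (n * n) ⟩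
        n * n * m    ∎

    step : ∀ {L steps} S (S∉L : ¬ 𝒮⟨ L ⟩ S) → Bounded (degree misses (elements P) S) →
           Partial L steps → Partial (extend L (Φ S) S∉L) (suc steps)
    step {L} {steps} S S∉L bounded′ partial = record
      { P₀ = onSphere P₀ S ; P₀⊆P = λ x∈ → P₀⊆P (proj₁ (∈-onSphere P₀ S x∈))
      ; P₀⊆B = λ {x} x∈ → B-extend L (Φ S) S∉L (P₀⊆B (proj₁ (∈-onSphere P₀ S x∈)))
                  (∈ˢ⇒Λ≡0 x S (proj₂ (∈-onSphere P₀ S x∈)))
      ; e = e ⊔ e′ ; bounded = Bounded-⊔ bounded bounded′
      ; loss = begin
          m                                                     ≤⟨ loss ⟩
          ∣ P₀ ∣ + steps * e                                    ≤⟨ ℕ.+-monoˡ-≤ (steps * e) (onSphere-loss P₀ S P₀⊆P) ⟩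
          ∣ onSphere P₀ S ∣ + e′ + steps * e                    ≡⟨ ℕ.+-assoc ∣ onSphere P₀ S ∣ e′ (steps * e) ⟩
          ∣ onSphere P₀ S ∣ + (e′ + steps * e)
            ≤⟨ ℕ.+-monoʳ-≤ ∣ onSphere P₀ S ∣ (ℕ.+-mono-≤ (ℕ.m≤n⊔m e e′) (ℕ.*-monoʳ-≤ steps (ℕ.m≤m⊔n e e′))) ⟩
          ∣ onSphere P₀ S ∣ + suc steps * (e ⊔ e′) ∎
      }
      where
      open Partial partial
      open ℕ.≤-Reasoning
      e′ = degree misses (elements P) S

    outside inside : AffineSubspace (suc d) → FinSubset Sphere
    outside L = record { elements = filter (¬? ∘ λ S → Φ S ∈ᵃ? L) (elements 𝒮) ; unique = Unique.filter⁺ _ (unique 𝒮) }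
    inside  L = record { elements = filter (λ S → Φ S ∈ᵃ? L) (elements 𝒮) ; unique = Unique.filter⁺ _ (unique 𝒮) }

    inhabited : ∀ {A : Set} (X : FinSubset A) → 0 < ∣ X ∣ → ∃[ x ] x ∈ᶠ X
    inhabited record { elements = x ∷ _ } _ = x , here refl

    -- At most D losses of size e ≤ δ m / D add up to at most δ m, and the hypothesis on `outside L`
    -- is the squared form of at most δ n excluded spheres.
    classify : ∀ {L steps} → steps ≤ D → ∣ outside L ∣ * ∣ outside L ∣ * m ≤ D * E * n → Partial L steps →
               Classifies P 𝒮 (√ δ²) L
    classify {L} {steps} steps≤D few partial = record
      { P₀ = P₀ ; 𝒮₀ = inside L
      ; P₀⊆P = P₀⊆P ; P₀⊆B⟨L⟩ = P₀⊆B
      ; 𝒮₀⊆𝒮   = λ S∈ → proj₁ (∈-filter⁻ (λ S → Φ S ∈ᵃ? L) S∈)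
      ; 𝒮₀⊆𝒮⟨L⟩ = λ S∈ → proj₂ (∈-filter⁻ (λ S → Φ S ∈ᵃ? L) {xs = elements 𝒮} S∈)
      ; P₀-large = subst (λ r → ℕ→ℝ ∣ P₀ ∣ ≥ℝ (1- √ r) ·ℕ m) (sym δ²≡DE/mn)
          (large {∣ P₀ ∣} {l} {m} {D * E} {m * n} (ℕ.m∸n+n≡m (unique-⊆⇒length-≤ (unique P₀) P₀⊆P)) (begin
            l * l * (m * n)              ≡⟨ solve 3 (λ l m n → l :* l :* (m :* n) := l :* l :* n :* m) refl l m n ⟩
            l * l * n * m                ≤⟨ ℕ.*-monoˡ-≤ m (ℕ.*-monoˡ-≤ n (*-self-mono-≤ l≤De)) ⟩
            (D * e) * (D * e) * n * m    ≤⟨ ℕ.*-monoˡ-≤ m (De²n≤DEm bounded) ⟩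
            D * E * m * m                ≡⟨ ℕ.*-assoc (D * E) m m ⟩
            D * E * (m * m)              ∎))
      ; 𝒮₀-large = subst (λ r → ℕ→ℝ ∣ inside L ∣ ≥ℝ (1- √ r) ·ℕ n) (sym δ²≡DE/mn)
          (large {∣ inside L ∣} {t} {n} {D * E} {m * n}
            (trans (ℕ.+-comm t _) (length-filter-∁ (λ S → Φ S ∈ᵃ? L) (elements 𝒮))) (begin
            t * t * (m * n)              ≡⟨ ℕ.*-assoc (t * t) m n ⟨
            t * t * m * n                ≤⟨ ℕ.*-monoˡ-≤ n few ⟩
            D * E * n * n                ≡⟨ ℕ.*-assoc (D * E) n n ⟩
            D * E * (n * n)              ∎))
      }
      where
      open Partial partial
      open ℕ.≤-Reasoning
      t = ∣ outside L ∣
      l = m ∸ ∣ P₀ ∣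
      l≤De : l ≤ D * e
      l≤De = ℕ.m≤n+o⇒m∸n≤o m ∣ P₀ ∣ (ℕ.≤-trans loss (ℕ.+-monoʳ-≤ ∣ P₀ ∣ (ℕ.*-monoˡ-≤ e steps≤D)))

    -- The fuel is D - dim L. When it runs out, dim L = d + 1, which contradicts `dim≤d` as soon as
    -- one point of `P₀` is found.
    grow : ∀ fuel {L} → fuel + dim L ≡ D → Partial L (suc (dim L)) → ∃ (Classifies P 𝒮 (√ δ²))
    grow zero {L} refl partial =
      contradiction (dim≤d L (P₀⊆B (proj₂ (inhabited P₀ P₀≢∅)))) (ℕ.<⇒≱ (ℕ.n<1+n d))
      where
      open Partial partial
      -- At this stage D + 1 choices have been made, and even (D + 1) e is less than m.
      P₀≢∅ : 0 < ∣ P₀ ∣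
      P₀≢∅ = ℕ.+-cancelʳ-< (suc D * e) 0 ∣ P₀ ∣ (ℕ.<-≤-trans (suc-D*e<m D {E} {e} {m} {n} (De²n≤DEm bounded) E-small) loss)
    grow (suc fuel) {L} eq partial = decide (∣ outside L ∣ * ∣ outside L ∣ * m ℕ.≤? D * E * n)
      where
      decide : Dec (∣ outside L ∣ * ∣ outside L ∣ * m ≤ D * E * n) → ∃ (Classifies P 𝒮 (√ δ²))
      -- Remaining fuel means dim L < D, so the dim L + 1 choices made so far are at most D.
      decide (yes few) = L , classify (subst (suc (dim L) ≤_) eq (s≤s (ℕ.m≤n+m (dim L) fuel))) few partial
      decide (no many) =
        let S , S∈ , bounded = chooseSphere (outside L)
              (λ S∈ → proj₁ (∈-filter⁻ (¬? ∘ λ S → Φ S ∈ᵃ? L) S∈)) (ℕ.≰⇒> many)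
            S∉L = proj₂ (∈-filter⁻ (¬? ∘ λ S → Φ S ∈ᵃ? L) {xs = elements 𝒮} S∈)
        in grow fuel (trans (ℕ.+-suc fuel (dim L)) eq) (step S S∉L bounded partial)

    existence : ∃ (Classifies P 𝒮 (√ δ²))
    existence =
      let L , dim≡0 , partial = start in
      grow D (trans (cong (_+_ D) dim≡0) (ℕ.+-identityʳ D)) (subst (λ j → Partial L (suc j)) (sym dim≡0) partial)

    -- Dimension of a classifying space

    module _ (γ : ℝ) (δ<γ : √ δ² <ℝ γ)
      (flats : (V : AffineSubspace d) → dim V + 2 ≡ d → ℕ→ℝ ∣ P ∩ (_∈ᵃ? V) ∣ ≤ℝ (1- γ) ·ℕ m) where

      -- L is an arbitrary classifying space here, so the base point x₀ of B(L) must come from the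
      -- size of `P₀` alone.
      dim≤1 : ∀ L → Classifies P 𝒮 (√ δ²) L → dim L ≤ 1
      dim≤1 L classifies = ℕ.≮⇒≥ λ 2≤dim →
        let _ , x₀∈P₀ = inhabited P₀ (large⇒nonempty P₀-large)
            V , dimV , B⊆V = B⊆codimensionTwo L 2≤dim (P₀⊆B⟨L⟩ x₀∈P₀)
        in large-<-absurd {√ δ²} {γ} δ<γ
             (unique-⊆⇒length-≤ (unique P₀) λ x∈ → ∈-filter⁺ (_∈ᵃ? V) (P₀⊆P x∈) (B⊆V (P₀⊆B⟨L⟩ x∈)))
             P₀-large (flats V (trans (cong (_+ 2) dimV) (ℕ.+-comm k 2)))
        where open Classifies classifies

      module _ (two : (1- √ δ²) ·ℕ n ≥ℝ ℕ→ℝ 2) where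

        twoSpheres : ∀ {A : Set} (X : FinSubset A) → 2 ≤ ∣ X ∣ → ∃₂ λ x y → x ∈ᶠ X × y ∈ᶠ X × x ≢ y
        twoSpheres record { elements = _ ∷ [] } (s≤s ())
        twoSpheres record { elements = x ∷ y ∷ _ ; unique = (x≢y All.∷ _) ∷ _ } _ =
          x , y , here refl , there (here refl) , x≢y

        -- The bound (1 - δ) n ≥ 2 leaves two different spheres in `𝒮₀`; as Φ is injective, their
        -- lifts cannot share a zero-dimensional L.
        conclusion : ∀ L → Classifies P 𝒮 (√ δ²) L →
          dim L ≡ 1 × IsCoaxalPencil 𝒮⟨ L ⟩
          × (∀ S S′ → 𝒮⟨ L ⟩ S → 𝒮⟨ L ⟩ S′ → S ≢ S′ → ∀ x → B⟨ L ⟩ x ⇔ (x ∈ˢ S × x ∈ˢ S′))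
        conclusion L classifies = onLine L (ℕ.≤-antisym (dim≤1 L classifies) 1≤dim)
          where
          open Classifies classifies
          1≤dim : 1 ≤ dim L
          1≤dim with S , S′ , S∈ , S′∈ , S≢S′ ← twoSpheres 𝒮₀
                   (large-trans-< {(1- √ δ²) ·ℕ n} {∣ 𝒮₀ ∣} {1} 𝒮₀-large two) =
            dim≥1 L (𝒮₀⊆𝒮⟨L⟩ S∈) (𝒮₀⊆𝒮⟨L⟩ S′∈) S≢S′
          -- Restated for arbitrary L, so that matching on dim L = 1 exposes the single basis vector
          -- that `Line` takes.
          onLine : ∀ L → dim L ≡ 1 → dim L ≡ 1 × IsCoaxalPencil 𝒮⟨ L ⟩
            × (∀ S S′ → 𝒮⟨ L ⟩ S → 𝒮⟨ L ⟩ S′ → S ≢ S′ → ∀ x → B⟨ L ⟩ x ⇔ (x ∈ˢ S × x ∈ˢ S′))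
          onLine record { origin = o ; dim = 1 ; basis = v ∷ [] ; independent = li } refl =
            refl , Line.isCoaxalPencil o v li , Line.B⇔section o v li

corollary2p12 :
  (q : ℕ) → OddPrimePower q → (F : FiniteField q) →
  (d : ℕ) → 2 ≤ d →
  let open VectorSpace F in
  (Q : QuadraticForm d) → QuadraticForm.Nondegenerate Q →
  let open Spheres F Q in
  (P : FinSubset Point) (𝒮 : FinSubset Sphere)
  .{{_ : NonZero ∣ P ∣}} .{{_ : NonZero ∣ 𝒮 ∣}} →
  0ℚ ℚ.≤ μ P 𝒮 → μ P 𝒮 ℚ.< + (d + 1) ℚ./ ((2 + d) ^ 2) →
  let δ = √ (ℕ→ℚ (d + 1) ℚ.* μ P 𝒮) in
  (γ : ℝ) → δ <ℝ γ →
  ((V : AffineSubspace d) → dim V + 2 ≡ d →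
    ℕ→ℝ ∣ P ∩ (_∈ᵃ? V) ∣ ≤ℝ (1- γ) ·ℕ ∣ P ∣) →
  ∃ (Classifies P 𝒮 δ)
  × (∀ L → Classifies P 𝒮 δ L → dim L ≤ 1)
  × ((1- δ) ·ℕ ∣ 𝒮 ∣ ≥ℝ ℕ→ℝ 2 →
      ∀ L → Classifies P 𝒮 δ L →
        dim L ≡ 1
        × IsCoaxalPencil 𝒮⟨ L ⟩
        × (∀ S S′ → 𝒮⟨ L ⟩ S → 𝒮⟨ L ⟩ S′ → S ≢ S′ →
            ∀ x → B⟨ L ⟩ x ⇔ (x ∈ˢ S × x ∈ˢ S′)))
-- Matching on 2 ≤ d turns d into 2 + k, so that flats of codimension two have dimension k.
corollary2p12 q _ F _ (s≤s (s≤s z≤n)) Q nondegenerate P 𝒮 _ μ< γ δ<γ flats =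
  existence μ< , dim≤1 μ< γ δ<γ flats , conclusion μ< γ δ<γ flats
  where open Classification F Q nondegenerate P 𝒮
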